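{- For every integer $n\ge 1$, the quintuple of statistics $(\mathrm{rlm},\mathrm{rlmin},\mathrm{w\overline{m}},\mathrm{des},(\underline{321}))$ is equally distributed with the quintuple $(\mathrm{rlm},\mathrm{w\overline{m}},\mathrm{rlmin},\mathrm{des},(\underline{321}))$ on $S_n$, and $$\sum_{\pi\in S_n}x^{\mathrm{w\overline{m}}(\pi)-1}y^{\mathrm{rlm}(\pi)}=(x+y)_{n-1},$$ where $(z)_0=1$ and $(z)_m=z(z+1)\cdots(z+m-1)$ for $m\ge 1$.
   Context: $S_n$ is the set of permutations $\pi=\pi_1\pi_2\cdots\pi_n$ of $[n]=\{1,\dots,n\}$. Statistics. For a word $w=w_1\cdots w_m$ of distinct integers, $w_i$ is an RL-maximum if $w_i>w_j$ for all $j>i$, and an RL-minimum if $w_i<w_j$ for all $j>i$; $\mathrm{rlmin}(w)$ is the number of RL-minima of $w$. For $\pi\in S_n$, $\mathrm{rlm}(\pi)$ is the number of RL-maxima of the (possibly empty) subword of $\pi$ consisting of the letters to the left of the letter $1$. An index $i$ is a weak excedance of $\pi$ if $\pi_i\ge i$; it is a mid-point of $\pi$ if there exist $j<i<k$ with $\pi_j>\pi_i>\pi_k$, and a non-mid-point otherwise. $\mathrm{w\overline{m}}(\pi)$ is the number of indices $i$ that are both a weak excedance and a non-mid-point of $\pi$. $\mathrm{des}(\pi)$ is the number of $i\in[n-1]$ with $\pi_i>\pi_{i+1}$. $(\underline{321})(\pi)$ is the number of occurrences in $\pi$ of the vincular pattern $\underline{321}$, in which all three letters must be adjacent, i.e.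 the number of $i\in\{1,\dots,n-2\}$ with $\pi_i>\pi_{i+1}>\pi_{i+2}$. Two tuples of statistics $(f_1,\dots,f_k)$ and $(g_1,\dots,g_k)$ are equally distributed on a finite set $X$ if for every tuple of values $(a_1,\dots,a_k)$ the number of $x\in X$ with $(f_1(x),\dots,f_k(x))=(a_1,\dots,a_k)$ equals the number of $x\in X$ with $(g_1(x),\dots,g_k(x))=(a_1,\dots,a_k)$. -}

module Defs where

open import Algebra.Bundles using (CommutativeRing)
open import Data.Bool.Base using (if_then_else_)
open import Data.Fin.Base using (Fin; toℕ)
import Data.Fin.Base as Fin
import Data.Fin.Properties as Fin
open import Data.List.Base
  using (List; []; _∷_; map; concatMap; filter; takeWhile; length; lookup; allFin;
         applyUpTo; foldr; _++_; [_])
open import Data.List.Properties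
  using (filter-all; filter-accept; filter-reject; ∷-injectiveˡ; ∷-injectiveʳ;
         applyUpTo-∷ʳ)
open import Data.List.Membership.Propositional using (_∈_; _∉_; find; lose)
open import Data.List.Membership.Propositional.Properties
  using (∈-map⁺; ∈-map⁻; ∈-concatMap⁺; ∈-concatMap⁻; ∈-∃++; ∈-applyUpTo⁻)
open import Data.List.Relation.Binary.Permutation.Propositional
  using (_↭_; ↭-refl; ↭-sym; ↭-trans; ↭-reflexive; prep; swap)
open import Data.List.Relation.Binary.Permutation.Propositional.Properties
  using (∈-resp-↭; drop-mid; ∷↭∷ʳ; ↭-empty-inv)
open import Data.List.Relation.Unary.All as All using (All; []; _∷_; all?)
open import Data.List.Relation.Unary.AllPairs using ([]; _∷_)
open import Data.List.Relation.Unary.Any using (here; there)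
open import Data.List.Relation.Unary.Unique.Propositional using (Unique)
import Data.List.Relation.Unary.Unique.Propositional.Properties as Unique
open import Data.Nat.Base using (ℕ; zero; suc; _+_; _≤_; _<_; _>_)
open import Data.Nat.Properties using (_≟_; _≤?_; _<?_; _>?_; suc-injective; <-irrefl)
open import Data.Product.Base using (_×_; _,_; ∃₂)
open import Data.Vec.Base using (Vec)
import Data.Vec.Base as Vec
import Data.Vec.Properties as Vec
open import Function.Bundles using (_⇔_; mk⇔)
open import Level using (Level)
open import Relation.Binary.PropositionalEquality
  using (_≡_; _≢_; refl; sym; trans; cong; subst)
open import Relation.Nullary using (Dec; does; contradiction)
open import Relation.Nullary.Decidable using (_×-dec_; ¬?)
open import Relation.Unary using (Pred; Decidable)

private
  variable
    a p : Level
    A : Set a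

------------------------------------------------------------------------
-- The symmetric group, in one-line notation with letters 1, …, n

Word : Set
Word = List ℕ

[1⋯_] : ℕ → Word
[1⋯ n ] = applyUpTo suc n

insertions : ℕ → Word → List Word
insertions x []      = [ x ∷ [] ]
insertions x (y ∷ w) = (x ∷ y ∷ w) ∷ map (y ∷_) (insertions x w)

-- A list of all permutations of [1⋯ n ]; by 𝔖-complete and 𝔖-unique
-- below, it contains each of them exactly once and nothing else.
𝔖 : ℕ → List Word
𝔖 zero    = [ [] ]
𝔖 (suc n) = concatMap (insertions (suc n)) (𝔖 n)

private
  ∈-insertions⇒↭ : ∀ {x w} v → w ∈ insertions x v → w ↭ x ∷ v
  ∈-insertions⇒↭ []      (here refl) = ↭-refl
  ∈-insertions⇒↭ (y ∷ v) (here refl) = ↭-refl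
  ∈-insertions⇒↭ (y ∷ v) (there w∈) with ∈-map⁻ (y ∷_) w∈
  ... | u , u∈ , refl =
    ↭-trans (prep y (∈-insertions⇒↭ v u∈)) (swap y _ ↭-refl)

  ∈-insertions : ∀ x us vs → us ++ x ∷ vs ∈ insertions x (us ++ vs)
  ∈-insertions x []       []       = here refl
  ∈-insertions x []       (v ∷ vs) = here refl
  ∈-insertions x (u ∷ us) vs       = there (∈-map⁺ (u ∷_) (∈-insertions x us vs))

  [1⋯suc] : ∀ n → suc n ∷ [1⋯ n ] ↭ [1⋯ suc n ]
  [1⋯suc] n = ↭-trans (∷↭∷ʳ (suc n) [1⋯ n ]) (↭-reflexive (applyUpTo-∷ʳ suc n))

  sound : ∀ n {w} → w ∈ 𝔖 n → w ↭ [1⋯ n ]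
  sound zero    (here refl) = ↭-refl
  sound (suc n) w∈ with find (∈-concatMap⁻ (insertions (suc n)) {xs = 𝔖 n} w∈)
  ... | v , v∈ , w∈v =
    ↭-trans (∈-insertions⇒↭ v w∈v)
      (↭-trans (prep (suc n) (sound n v∈)) ([1⋯suc] n))

  complete : ∀ n {w} → w ↭ [1⋯ n ] → w ∈ 𝔖 n
  complete zero    w↭ = here (↭-empty-inv w↭)
  complete (suc n) w↭
    with w↭′ ← ↭-trans w↭ (↭-sym ([1⋯suc] n))
    with us , vs , refl ← ∈-∃++ (∈-resp-↭ (↭-sym w↭′) (here refl))
    = ∈-concatMap⁺ (insertions (suc n))
        (lose (complete n (drop-mid us [] w↭′)) (∈-insertions (suc n) us vs))

  sucn∉ : ∀ n {w} → w ∈ 𝔖 n → suc n ∉ w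
  sucn∉ n w∈ sucn∈w
    with i , i<n , eq ← ∈-applyUpTo⁻ suc (∈-resp-↭ (sound n w∈) sucn∈w)
    = <-irrefl (sym (suc-injective eq)) i<n

  remove-insertions : ∀ {x w} v → x ∉ v → w ∈ insertions x v →
                      filter (λ y → ¬? (x ≟ y)) w ≡ v
  remove-insertions {x} [] x∉ (here refl) =
    filter-reject (λ y → ¬? (x ≟ y)) (λ x≢x → x≢x refl)
  remove-insertions {x} (y ∷ v) x∉ (here refl) =
    trans (filter-reject (λ y → ¬? (x ≟ y)) (λ x≢x → x≢x refl))
          (filter-all (λ y → ¬? (x ≟ y))
            (All.tabulate (λ z∈ x≡z → x∉ (subst (_∈ y ∷ v) (sym x≡z) z∈))))
  remove-insertions {x} (y ∷ v) x∉ (there w∈) with ∈-map⁻ (y ∷_) w∈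
  ... | u , u∈ , refl =
    trans (filter-accept (λ y → ¬? (x ≟ y)) (λ x≡y → x∉ (here x≡y)))
          (cong (y ∷_) (remove-insertions v (λ x∈ → x∉ (there x∈)) u∈))

  insertions-unique : ∀ {x} v → x ∉ v → Unique (insertions x v)
  insertions-unique []      x∉ = [] ∷ []
  insertions-unique {x} (y ∷ v) x∉ =
    All.tabulate head≢ ∷
    Unique.map⁺ ∷-injectiveʳ (insertions-unique v (λ x∈ → x∉ (there x∈)))
    where
    head≢ : ∀ {w} → w ∈ map (y ∷_) (insertions x v) → x ∷ y ∷ v ≢ w
    head≢ w∈ eq with ∈-map⁻ (y ∷_) w∈
    ... | u , _ , refl = x∉ (here (∷-injectiveˡ eq))

  concatMap-unique : ∀ {x} vs → (∀ {v} → v ∈ vs → x ∉ v) → Unique vs →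
                     Unique (concatMap (insertions x) vs)
  concatMap-unique     []       x∉ [] = []
  concatMap-unique {x} (v ∷ vs) x∉ (v≢ ∷ vs!) =
    Unique.++⁺ (insertions-unique v (x∉ (here refl)))
               (concatMap-unique vs (λ v∈ → x∉ (there v∈)) vs!)
               disjoint
    where
    disjoint : ∀ {w} → w ∈ insertions x v × w ∈ concatMap (insertions x) vs → _
    disjoint (w∈ , w∈′) with find (∈-concatMap⁻ (insertions x) {xs = vs} w∈′)
    ... | v′ , v′∈ , w∈v′ = contradiction
      (trans (sym (remove-insertions v (x∉ (here refl)) w∈))
             (remove-insertions v′ (x∉ (there v′∈)) w∈v′))
      (All.lookup v≢ v′∈)

𝔖-complete : ∀ n {w} → w ∈ 𝔖 n ⇔ (w ↭ [1⋯ n ])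
𝔖-complete n = mk⇔ (sound n) (complete n)

𝔖-unique : ∀ n → Unique (𝔖 n)
𝔖-unique zero    = [] ∷ []
𝔖-unique (suc n) = concatMap-unique (𝔖 n) (sucn∉ n) (𝔖-unique n)

------------------------------------------------------------------------
-- Statistics

rlmax : Word → ℕ
rlmax []      = 0
rlmax (x ∷ w) = (if does (all? (x >?_) w) then 1 else 0) + rlmax w

rlmin : Word → ℕ
rlmin []      = 0
rlmin (x ∷ w) = (if does (all? (x <?_) w) then 1 else 0) + rlmin w

leftOf1 : Word → Word
leftOf1 = takeWhile (λ x → ¬? (x ≟ 1))

rlm : Word → ℕ
rlm π = rlmax (leftOf1 π)

-- Positions are counted from 0 by Fin, but from 1 in the definition of
-- a weak excedance.
WeakExcedance : (π : Word) → Pred (Fin (length π)) _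
WeakExcedance π i = suc (toℕ i) ≤ lookup π i

MidPoint : (π : Word) → Pred (Fin (length π)) _
MidPoint π i = ∃₂ λ j k →
  (j Fin.< i × i Fin.< k) × (lookup π j > lookup π i × lookup π i > lookup π k)

weakExcedance? : ∀ π → Decidable (WeakExcedance π)
weakExcedance? π i = suc (toℕ i) ≤? lookup π i

midPoint? : ∀ π → Decidable (MidPoint π)
midPoint? π i = Fin.any? λ j → Fin.any? λ k →
  (j Fin.<? i ×-dec i Fin.<? k) ×-dec
  (lookup π j >? lookup π i ×-dec lookup π i >? lookup π k)

-- Weak excedances that are non-mid-points.  For n ≥ 1 and π in 𝔖 n we
-- have wnm π ≥ 1 (consider the position of the letter n), so that
-- truncated subtraction is harmless in wnm π ∸ 1.
wnm : Word → ℕ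
wnm π = length (filter (λ i → weakExcedance? π i ×-dec ¬? (midPoint? π i))
                       (allFin (length π)))

des : Word → ℕ
des (x ∷ w@(y ∷ _)) = (if does (x >? y) then 1 else 0) + des w
des _               = 0

-- Occurrences of the pattern 321 with all three letters adjacent.
adj321 : Word → ℕ
adj321 (x ∷ w@(y ∷ z ∷ _)) =
  (if does (x >? y ×-dec y >? z) then 1 else 0) + adj321 w
adj321 _                   = 0

------------------------------------------------------------------------
-- Equidistribution

count : {P : Pred A p} → Decidable P → List A → ℕ
count P? xs = length (filter P? xs)

values : ∀ {k} → Vec (A → ℕ) k → A → Vec ℕ k
values fs x = Vec.map (λ f → f x) fs

-- Meant for a list xs without repetitions, standing for the finite set
-- of its elements.
EquallyDistributedOn : ∀ {k} → List A → (fs gs : Vec (A → ℕ) k) → Set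
EquallyDistributedOn {k = k} xs fs gs = (as : Vec ℕ k) →
  count (λ x → values fs x ≟ᵛ as) xs ≡ count (λ x → values gs x ≟ᵛ as) xs
  where
  _≟ᵛ_ : (us vs : Vec ℕ k) → Dec (us ≡ vs)
  _≟ᵛ_ = Vec.≡-dec _≟_

------------------------------------------------------------------------
-- Sums and rising factorials

-- An identity between polynomials in x and y with integer coefficients
-- is expressed by its validity for all elements x and y of all
-- commutative rings (ℤ[x,y] being one of them).
module Polynomial {c ℓ} (R : CommutativeRing c ℓ) where
  private
    module R = CommutativeRing R
  open R using (Carrier; 0#; 1#)
  open import Algebra.Properties.Semiring.Exp R.semiring public using (_^_)
  open import Algebra.Properties.Semiring.Mult R.semiring using ()
    renaming (_×_ to _·_)

  sumOver : List A → (A → Carrier) → Carrier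
  sumOver xs f = foldr (λ x s → f x R.+ s) 0# xs

  infix 10 sumOver
  syntax sumOver xs (λ x → e) = ∑[ x ∈ xs ] e

  rising : Carrier → ℕ → Carrier
  rising z zero    = 1#
  rising z (suc m) = rising z m R.* (z R.+ m · 1#)

{-# OPTIONS --safe #-}

-- Among weak excedances, the non-mid-points are exactly the left-to-right
-- maxima (count the letters smaller than π_i), so wnm = lrmax.
--
-- Equidistribution.  Build π by inserting 1, 2, …, n into a word some of
-- whose gaps are marked as open (a Laguerre history).  The i-th letter is a
-- RL-minimum iff it enters the last open gap, a LR-maximum iff it closes the
-- left side of the first one, and contributes to rlm iff it closes the right
-- side of the last open gap before 1; descents and consecutive 321's only
-- depend on which sides it closes.  Hence the generating function is a
-- weighted count of walks on the numbers (i , j) of open gaps on the two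
-- sides of 1, with x, y, q marking lrmax, rlmin, rlm.  The gap-creating and
-- gap-closing steps are the raising and lowering operators of a tensor product
-- of two lowest weight modules of sl₂ with parameters x + q and y.  Starting from the lowest weight vector, such
-- a walk only sees the parameter x + q + y of the total module until all gaps
-- before 1 are closed, and afterwards each up-down pair of steps has weight
-- (x + k)(y + k): everything is symmetric in x and y.
--
-- Generating function.  Insert the letters n, n - 1, …, 2 into the word 1:
-- each step multiplies the sum of x^(lrmax ∸ 1) q^rlm by x + q + the number of
-- letters inserted before.  The recursion of 𝔖 fits this after complementing.

module Submission where

open import Defs
open import Algebra.Bundles using (CommutativeRing; CommutativeSemiring)
open import Algebra.Structures.Biased using (IsCommutativeSemiringˡ)
open import Data.Bool.Base using (Bool; true; false; if_then_else_; not; _∧_; _∨_)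
open import Data.Bool.Properties using (∨-identityʳ; ∨-zeroʳ)
open import Data.Fin.Base as Fin using (Fin; zero; suc; toℕ)
import Data.Fin.Properties as Fin
open import Data.List.Base
  using (List; []; _∷_; [_]; map; _++_; _ʳ++_; concatMap; foldr; length; lookup;
         reverse; allFin; tabulate; applyUpTo; applyDownFrom)
open import Data.List.Membership.Propositional using (_∈_)
open import Data.List.Membership.Propositional.Properties using (∈-lookup; ∈-map⁺; ∈-map⁻)
open import Data.List.Membership.Propositional.Properties.WithK using (unique∧set⇒bag)
open import Data.List.Properties
  using (++-assoc; ++-identityʳ; concatMap-++; filter-accept; filter-none; filter-reject;
         length-++; length-applyUpTo; map-++; map-applyUpTo; map-cong; map-id; map-tabulate;
         map-∘; reverse-applyUpTo)
open import Data.List.Relation.Binary.BagAndSetEquality using (∼bag⇒↭)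
open import Data.List.Relation.Binary.Permutation.Propositional
  using (_↭_; ↭-refl; ↭-sym; ↭-trans; ↭-reflexive; ↭-prep; ↭-isEquivalence; ↭⇒↭ₛ;
         module PermutationReasoning)
open import Data.List.Relation.Binary.Permutation.Propositional.Properties
  using (All-resp-↭; ++-isCommutativeMonoid; ++⁺; ++⁺ˡ; filter-↭; map⁺; shifts; ∈-resp-↭;
         ↭-length; ↭-reverse)
import Data.List.Relation.Binary.Permutation.Setoid.Properties as Setoid↭
open import Data.List.Relation.Unary.All as All using (All; []; _∷_; all?)
import Data.List.Relation.Unary.All.Properties as All
open import Data.List.Relation.Unary.AllPairs using ([]; _∷_)
open import Data.List.Relation.Unary.Any using (here; there; index)
open import Data.List.Relation.Unary.Any.Properties using (lookup-index)
open import Data.List.Relation.Unary.Unique.Propositional using (Unique)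
import Data.List.Relation.Unary.Unique.Propositional.Properties as Unique
open import Data.Nat.Base as ℕ
  using (ℕ; zero; suc; pred; _∸_; _≤_; _<_; _≥_; _<ᵇ_; _≡ᵇ_; z≤n; s≤s; z<s)
import Data.Nat.Properties as ℕ
open import Algebra.Properties.CommutativeSemigroup ℕ.+-commutativeSemigroup
  using (x∙yz≈y∙xz)
open import Data.Product.Base using (_×_; _,_; proj₁; proj₂; ∃₂)
open import Data.Vec.Base as Vec using (Vec; []; _∷_)
import Data.Vec.Properties as Vec
open import Function.Base using (_∘_; id)
open import Function.Bundles using (_⇔_; mk⇔; Equivalence)
open import Level using (0ℓ)
open import Relation.Binary.PropositionalEquality as ≡ using (_≡_; _≢_)
open import Relation.Nullary using (does; contradiction; yes; no; ¬_)
open import Relation.Nullary.Decidable using (dec-true; dec-false)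
open import Relation.Unary using (Pred; Decidable)

-- The algebra of weighted histories

module HistoryAlgebra {c ℓ} (S : CommutativeSemiring c ℓ) where

  open CommutativeSemiring S hiding (zero)
  open import Algebra.Properties.Semiring.Mult semiring using (×-homo-+)
    renaming (_×_ to _·_)
  open import Algebra.Solver.Ring.NaturalCoefficients.Default S
    using (solve; _:+_; _:*_; _:=_; con)
  open import Relation.Binary.Reasoning.Setoid setoid

  ι : ℕ → Carrier
  ι n = n · 1#

  ι-+ : ∀ m n → ι (m ℕ.+ n) ≈ ι m + ι n
  ι-+ = ×-homo-+ 1#

  module Weighted (x y q d t : Carrier) where

    -- completions₀ m j sums the weights of the ways to insert m more letters
    -- when no gap before 1 is open and j + 1 gaps after 1 are, counting the
    -- end of the word, which stays open.  completions m i j does so when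
    -- i + 1 gaps before 1 and j + 1 gaps after 1 are open.
    stay₀ : ℕ → Carrier
    stay₀ zero    = x * y
    -- Closing only the left side weighs x in the first gap, y at the end of the word and 1 in the j
    -- gaps between. Closing only the right side of one of the j + 1 inner gaps adds a descent and a
    -- consecutive 321.
    stay₀ (suc j) = x + y + ι j + d * t * ι (suc j)

    -- Both sides are closed here, which is impossible at the end of the word. Of the other gaps,
    -- only the first yields an LR-maximum.
    fall₀ : (ℕ → Carrier) → ℕ → Carrier
    fall₀ f zero    = 0#
    fall₀ f (suc j) = (x + ι j) * f j

    completions₀ : ℕ → ℕ → Carrier
    completions₀ zero    zero    = 1#
    completions₀ zero    (suc j) = 0#
    completions₀ (suc m) j =
      -- The three summands leave both sides of the chosen gap open, close one side, and close both.
      d * ((y + ι j) * completions₀ m (suc j)) +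
      stay₀ j * completions₀ m j +
      fall₀ (completions₀ m) j

    -- Here k is i + j, so there are k + 1 inner gaps. The factor q belongs to closing the right
    -- side of the last open gap before 1.
    stay : ℕ → Carrier
    stay k = x + y + ι k + d * t * (q + ι k)

    raise : (ℕ → ℕ → Carrier) → ℕ → ℕ → Carrier
    raise f i j = ι (suc i) * f (suc i) j + (y + ι j) * f i (suc j)

    -- At index `suc i` at least two gaps are open before 1, so the first one (x) and the last one
    -- (q) differ. A single open gap is both and is left to `exit`.
    fallˡ : (ℕ → ℕ → Carrier) → ℕ → ℕ → Carrier
    fallˡ f zero    j = 0#
    fallˡ f (suc i) j = (x + q + ι i) * f i j

    fallʳ : (ℕ → ℕ → Carrier) → ℕ → ℕ → Carrier
    fallʳ f i zero    = 0#
    fallʳ f i (suc j) = ι (suc j) * f i j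

    fall : (ℕ → ℕ → Carrier) → ℕ → ℕ → Carrier
    fall f i j = fallˡ f i j + fallʳ f i j

    -- Closing the only open gap before 1.
    exit : (ℕ → Carrier) → ℕ → ℕ → Carrier
    exit f zero    j = f j
    exit f (suc i) j = 0#

    completions : ℕ → ℕ → ℕ → Carrier
    completions zero    i j = 0#
    completions (suc m) i j =
      d * raise (completions m) i j +
      stay (i ℕ.+ j) * completions m i j +
      fall (completions m) i j +
      x * q * exit (completions₀ m) i j

    -- The summands are the two markings of the word 1. Its letter is an RL-minimum; an open gap
    -- before it counts as a descent, a closed one makes it an LR-maximum.
    total : ℕ → Carrier
    total m = y * d * completions m 0 0 + x * y * completions₀ m 0

    raise₀ : (ℕ → Carrier) → ℕ → Carrier
    raise₀ f j = (y + ι j) * f (suc j)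

    -- Evaluation of f at the k-th raising of the lowest weight vector.
    at₀ : ℕ → (ℕ → Carrier) → Carrier
    at₀ zero    f = f 0
    at₀ (suc k) f = at₀ k (raise₀ f)

    at : ℕ → (ℕ → ℕ → Carrier) → Carrier
    at zero    f = f 0 0
    at (suc k) f = at k (raise f)

    at₀-cong : ∀ k {f g} → (∀ j → f j ≈ g j) → at₀ k f ≈ at₀ k g
    at₀-cong zero    f≈g = f≈g 0
    at₀-cong (suc k) f≈g = at₀-cong k λ j → *-congˡ (f≈g (suc j))

    at₀-+ : ∀ k f g → at₀ k (λ j → f j + g j) ≈ at₀ k f + at₀ k g
    at₀-+ zero    f g = refl
    at₀-+ (suc k) f g =
      trans (at₀-cong k λ j → distribˡ _ _ _) (at₀-+ k (raise₀ f) (raise₀ g))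

    at₀-scale : ∀ k s f → at₀ k (λ j → s j * f j) ≈ s k * at₀ k f
    at₀-scale zero    s f = refl
    at₀-scale (suc k) s f = trans
      (at₀-cong k λ j →
        solve 3 (λ a b c → a :* (b :* c) := b :* (a :* c)) refl
          (y + ι j) (s (suc j)) (f (suc j)))
      (at₀-scale k (λ j → s (suc j)) (raise₀ f))

    at-cong : ∀ k {f g} → (∀ i j → f i j ≈ g i j) → at k f ≈ at k g
    at-cong zero    f≈g = f≈g 0 0
    at-cong (suc k) f≈g =
      at-cong k λ i j → +-cong (*-congˡ (f≈g (suc i) j)) (*-congˡ (f≈g i (suc j)))

    at-+ : ∀ k f g → at k (λ i j → f i j + g i j) ≈ at k f + at k g
    at-+ zero    f g = refl
    at-+ (suc k) f g = trans
      (at-cong k λ i j →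
        solve 6 (λ a b e f g h → a :* (b :+ e) :+ f :* (g :+ h) :=
                                 a :* b :+ f :* g :+ (a :* e :+ f :* h)) refl
          (ι (suc i)) (f (suc i) j) (g (suc i) j) (y + ι j) (f i (suc j)) (g i (suc j)))
      (at-+ k (raise f) (raise g))

    -- Each raising increases i + j by one, so the k-th raising only involves states with i + j = k.
    at-scale : ∀ k s f → at k (λ i j → s (i ℕ.+ j) * f i j) ≈ s k * at k f
    at-scale zero    s f = refl
    at-scale (suc k) s f = trans
      (at-cong k λ i j → begin
        ι (suc i) * (s (suc i ℕ.+ j) * f (suc i) j) +
        (y + ι j) * (s (i ℕ.+ suc j) * f i (suc j))
          ≡⟨ ≡.cong (λ n → ι (suc i) * (s (suc i ℕ.+ j) * f (suc i) j) +
                           (y + ι j) * (s n * f i (suc j))) (ℕ.+-suc i j) ⟩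
        ι (suc i) * (s (suc i ℕ.+ j) * f (suc i) j) +
        (y + ι j) * (s (suc i ℕ.+ j) * f i (suc j))
          ≈⟨ solve 5 (λ a s b c e → a :* (s :* b) :+ c :* (s :* e) :=
                                    s :* (a :* b :+ c :* e)) refl
               (ι (suc i)) (s (suc i ℕ.+ j)) (f (suc i) j) (y + ι j) (f i (suc j)) ⟩
        s (suc i ℕ.+ j) * raise f i j ∎)
      (at-scale k (λ n → s (suc n)) (raise f))

    -- The relation [E , F] = H of sl₂.
    weight : ℕ → Carrier
    weight k = x + q + y + (ι k + ι k)

    raise-fall : ∀ f i j →
      raise (fall f) i j ≈ fall (raise f) i j + weight (i ℕ.+ j) * f i j
    raise-fall f i j = trans (lemma i j)
      (+-congˡ (*-congʳ (+-congˡ (+-cong (sym (ι-+ i j)) (sym (ι-+ i j))))))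
      where
      -- Raising on one side of 1 commutes with lowering on the other. The left side contributes x +
      -- q + 2i to the commutator and the right side y + 2j.
      lemma : ∀ i j → raise (fall f) i j ≈
        fall (raise f) i j + (x + q + y + ((ι i + ι j) + (ι i + ι j))) * f i j
      lemma zero zero =
        solve 4 (λ x y q f →
          (con 1 :+ con 0) :* ((x :+ q :+ con 0) :* f :+ con 0) :+
          (y :+ con 0) :* (con 0 :+ (con 1 :+ con 0) :* f) :=
          con 0 :+ con 0 :+ (x :+ q :+ y :+ ((con 0 :+ con 0) :+ (con 0 :+ con 0))) :* f)
          refl x y q (f 0 0)
      lemma zero (suc j) =
        solve 6 (λ x y q j f g →
          (con 1 :+ con 0) :* ((x :+ q :+ con 0) :* f :+ (con 1 :+ j) :* g) :+
          (y :+ (con 1 :+ j)) :* (con 0 :+ (con 1 :+ (con 1 :+ j)) :* f) :=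
          con 0 :+ (con 1 :+ j) :* ((con 1 :+ con 0) :* g :+ (y :+ j) :* f) :+
          (x :+ q :+ y :+ ((con 0 :+ (con 1 :+ j)) :+ (con 0 :+ (con 1 :+ j)))) :* f)
          refl x y q (ι j) (f 0 (suc j)) (f 1 j)
      lemma (suc i) zero =
        solve 6 (λ x y q i f g →
          (con 1 :+ (con 1 :+ i)) :* ((x :+ q :+ (con 1 :+ i)) :* f :+ con 0) :+
          (y :+ con 0) :* ((x :+ q :+ i) :* g :+ (con 1 :+ con 0) :* f) :=
          (x :+ q :+ i) :* ((con 1 :+ i) :* f :+ (y :+ con 0) :* g) :+ con 0 :+
          (x :+ q :+ y :+ (((con 1 :+ i) :+ con 0) :+ ((con 1 :+ i) :+ con 0))) :* f)
          refl x y q (ι i) (f (suc i) 0) (f i 1)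
      lemma (suc i) (suc j) =
        solve 8 (λ x y q i j f g h →
          (con 1 :+ (con 1 :+ i)) :* ((x :+ q :+ (con 1 :+ i)) :* f :+ (con 1 :+ j) :* g) :+
          (y :+ (con 1 :+ j)) :* ((x :+ q :+ i) :* h :+ (con 1 :+ (con 1 :+ j)) :* f) :=
          (x :+ q :+ i) :* ((con 1 :+ i) :* f :+ (y :+ (con 1 :+ j)) :* h) :+
          (con 1 :+ j) :* ((con 1 :+ (con 1 :+ i)) :* g :+ (y :+ j) :* f) :+
          (x :+ q :+ y :+ (((con 1 :+ i) :+ (con 1 :+ j)) :+ ((con 1 :+ i) :+ (con 1 :+ j)))) :* f)
          refl x y q (ι i) (ι j) (f (suc i) (suc j)) (f (suc (suc i)) j) (f i (suc (suc j)))

    -- The scalar by which lowering takes the k-th raising of the lowest weight vector to the one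
    -- before it; in closed form k (x + q + y + k - 1).
    casimir : ℕ → Carrier
    casimir zero    = 0#
    casimir (suc k) = casimir k + weight k

    lower : (ℕ → Carrier) → ℕ → Carrier
    lower a zero    = 0#
    lower a (suc k) = casimir (suc k) * a k

    -- Lowering moves past the raisings one at a time, each passage adding a weight, and vanishes on
    -- the lowest weight vector.
    at-fall : ∀ k f → at k (fall f) ≈ lower (λ n → at n f) k
    at-fall zero    f = +-identityˡ 0#
    at-fall (suc k) f = begin
      at k (raise (fall f))
        ≈⟨ at-cong k (raise-fall f) ⟩
      at k (λ i j → fall (raise f) i j + weight (i ℕ.+ j) * f i j)
        ≈⟨ at-+ k (fall (raise f)) (λ i j → weight (i ℕ.+ j) * f i j) ⟩
      at k (fall (raise f)) + at k (λ i j → weight (i ℕ.+ j) * f i j)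
        ≈⟨ +-cong (trans (at-fall k (raise f)) (lower-raise k)) (at-scale k weight f) ⟩
      casimir k * at k f + weight k * at k f
        ≈⟨ distribʳ _ _ _ ⟨
      casimir (suc k) * at k f ∎
      where
      lower-raise : ∀ k → lower (λ n → at n (raise f)) k ≈ casimir k * at k f
      lower-raise zero    = sym (zeroˡ _)
      lower-raise (suc k) = refl

    -- `exit` discards all states with a second open gap before 1, so only raisings on the right
    -- side survive.
    at-exit : ∀ k f → at k (exit f) ≈ at₀ k f
    at-exit zero    f = refl
    at-exit (suc k) f = trans (at-cong k raise-exit) (at-exit k (raise₀ f))
      where
      raise-exit : ∀ i j → raise (exit f) i j ≈ exit (raise₀ f) i j
      raise-exit zero    j = trans (+-congʳ (zeroʳ _)) (+-identityˡ _)
      raise-exit (suc i) j =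
        trans (+-cong (zeroʳ _) (zeroʳ _)) (+-identityˡ 0#)

    -- A raising followed by a lowering returns to the same j, so their composite is diagonal with
    -- entries (y + j)(x + j).
    at₀-fall₀ : ∀ k f → at₀ (suc k) (fall₀ f) ≈ (y + ι k) * (x + ι k) * at₀ k f
    at₀-fall₀ k f = trans
      (at₀-cong k λ j → sym (*-assoc (y + ι j) (x + ι j) (f j)))
      (at₀-scale k (λ j → (y + ι j) * (x + ι j)) f)

    lower₀ : (ℕ → Carrier) → ℕ → Carrier
    lower₀ a zero    = 0#
    lower₀ a (suc k) = (y + ι k) * (x + ι k) * a k

    -- The recurrences of at₀ k (completions₀ m) and of y * at k (completions m);
    -- their coefficients are symmetric in x and y.
    moment₀ : ℕ → ℕ → Carrier
    moment₀ zero    zero    = 1#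
    moment₀ zero    (suc k) = 0#
    moment₀ (suc m) k =
      d * moment₀ m (suc k) + stay₀ k * moment₀ m k + lower₀ (moment₀ m) k

    moment : ℕ → ℕ → Carrier
    moment zero    k = 0#
    moment (suc m) k =
      d * moment m (suc k) + stay k * moment m k + lower (moment m) k +
      x * y * q * moment₀ m k

    at₀-0# : ∀ k {f} → (∀ j → f j ≈ 0#) → at₀ k f ≈ 0#
    at₀-0# zero    f≈0 = f≈0 0
    at₀-0# (suc k) f≈0 = at₀-0# k λ j → trans (*-congˡ (f≈0 (suc j))) (zeroʳ _)

    at-0# : ∀ k {f} → (∀ i j → f i j ≈ 0#) → at k f ≈ 0#
    at-0# zero    f≈0 = f≈0 0 0
    at-0# (suc k) f≈0 = at-0# k λ i j → trans
      (+-cong (trans (*-congˡ (f≈0 (suc i) j)) (zeroʳ _))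
              (trans (*-congˡ (f≈0 i (suc j))) (zeroʳ _)))
      (+-identityˡ 0#)

    at₀-completions₀ : ∀ m k → at₀ k (completions₀ m) ≈ moment₀ m k
    at₀-completions₀ zero zero    = refl
    at₀-completions₀ zero (suc k) = at₀-0# k λ j → zeroʳ _
    at₀-completions₀ (suc m) k = begin
      at₀ k (λ j → d * raise₀ f j + stay₀ j * f j + fall₀ f j)
        ≈⟨ at₀-+ k (λ j → d * raise₀ f j + stay₀ j * f j) (fall₀ f) ⟩
      at₀ k (λ j → d * raise₀ f j + stay₀ j * f j) + at₀ k (fall₀ f)
        ≈⟨ +-cong (at₀-+ k (λ j → d * raise₀ f j) (λ j → stay₀ j * f j)) (fall-eq k) ⟩
      at₀ k (λ j → d * raise₀ f j) + at₀ k (λ j → stay₀ j * f j) + lower₀ (moment₀ m) k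
        ≈⟨ +-congʳ (+-cong
             (trans (at₀-scale k (λ _ → d) (raise₀ f)) (*-congˡ (at₀-completions₀ m (suc k))))
             (trans (at₀-scale k stay₀ f) (*-congˡ (at₀-completions₀ m k)))) ⟩
      moment₀ (suc m) k ∎
      where
      f : ℕ → Carrier
      f = completions₀ m
      fall-eq : ∀ k → at₀ k (fall₀ f) ≈ lower₀ (moment₀ m) k
      fall-eq zero    = refl
      fall-eq (suc k) = trans (at₀-fall₀ k f) (*-congˡ (at₀-completions₀ m k))

    -- The factor y, present in `total`, turns the exit weight `x * q` into the symmetric
    -- `x * y * q`.
    at-completions : ∀ m k → y * at k (completions m) ≈ moment m k
    at-completions zero k = trans (*-congˡ (at-0# k (λ _ _ → refl))) (zeroʳ y)
    at-completions (suc m) k = begin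
      y * at k (λ i j → d * raise f i j + stay (i ℕ.+ j) * f i j + fall f i j + x * q * e i j)
        ≈⟨ *-congˡ (trans
             (at-+ k (λ i j → d * raise f i j + stay (i ℕ.+ j) * f i j + fall f i j)
                     (λ i j → x * q * e i j))
             (+-congʳ (trans
               (at-+ k (λ i j → d * raise f i j + stay (i ℕ.+ j) * f i j) (fall f))
               (+-congʳ
                 (at-+ k (λ i j → d * raise f i j) (λ i j → stay (i ℕ.+ j) * f i j)))))) ⟩
      y * (at k (λ i j → d * raise f i j) + at k (λ i j → stay (i ℕ.+ j) * f i j) +
           at k (fall f) + at k (λ i j → x * q * e i j))
        ≈⟨ *-congˡ (+-cong (+-congʳ (+-cong (at-scale k (λ _ → d) (raise f)) (at-scale k stay f)))
             (trans (at-scale k (λ _ → x * q) e)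
                    (*-congˡ (trans (at-exit k (completions₀ m)) (at₀-completions₀ m k))))) ⟩
      y * (d * at (suc k) f + stay k * at k f + at k (fall f) + x * q * moment₀ m k)
        ≈⟨ solve 9 (λ y d a s b c x q v →
             y :* (d :* a :+ s :* b :+ c :+ x :* q :* v) :=
             d :* (y :* a) :+ s :* (y :* b) :+ y :* c :+ x :* y :* q :* v) refl
             y d (at (suc k) f) (stay k) (at k f) (at k (fall f)) x q (moment₀ m k) ⟩
      d * (y * at (suc k) f) + stay k * (y * at k f) + y * at k (fall f) +
      x * y * q * moment₀ m k
        ≈⟨ +-congʳ (+-cong (+-cong (*-congˡ (at-completions m (suc k)))
                                    (*-congˡ (at-completions m k))) (fall-eq k)) ⟩
      moment (suc m) k ∎
      where
      f e : ℕ → ℕ → Carrier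
      f = completions m
      e = exit (completions₀ m)
      fall-eq : ∀ k → y * at k (fall f) ≈ lower (moment m) k
      fall-eq zero    = trans (*-congˡ (at-fall 0 f)) (zeroʳ y)
      fall-eq (suc k) = begin
        y * at (suc k) (fall f)          ≈⟨ *-congˡ (at-fall (suc k) f) ⟩
        y * (casimir (suc k) * at k f)   ≈⟨ solve 3 (λ a b c → a :* (b :* c) := b :* (a :* c))
                                              refl y (casimir (suc k)) (at k f) ⟩
        casimir (suc k) * (y * at k f)   ≈⟨ *-congˡ (at-completions m k) ⟩
        casimir (suc k) * moment m k     ∎

    total-moments : ∀ m → total m ≈ d * moment m 0 + x * y * moment₀ m 0
    total-moments m = +-cong
      (begin
        y * d * completions m 0 0    ≈⟨ *-congʳ (*-comm y d) ⟩
        d * y * completions m 0 0    ≈⟨ *-assoc d y _ ⟩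
        d * (y * completions m 0 0)  ≈⟨ *-congˡ (at-completions m 0) ⟩
        d * moment m 0               ∎)
      (*-congˡ (at₀-completions₀ m 0))

  -- Symmetry of the total weight in x and y

  module _ (x y q d t : Carrier) where
    private
      module A = Weighted x y q d t
      module B = Weighted y x q d t

    stay₀-sym : ∀ k → A.stay₀ k ≈ B.stay₀ k
    stay₀-sym zero    = *-comm x y
    stay₀-sym (suc k) = +-congʳ (+-congʳ (+-comm x y))

    stay-sym : ∀ k → A.stay k ≈ B.stay k
    stay-sym k = +-congʳ (+-congʳ (+-comm x y))

    casimir-sym : ∀ k → A.casimir k ≈ B.casimir k
    casimir-sym zero    = refl
    casimir-sym (suc k) = +-cong (casimir-sym k)
      (+-congʳ (solve 3 (λ x q y → x :+ q :+ y := y :+ q :+ x) refl x q y))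

    moment₀-sym : ∀ m k → A.moment₀ m k ≈ B.moment₀ m k
    moment₀-sym zero    zero    = refl
    moment₀-sym zero    (suc k) = refl
    moment₀-sym (suc m) k =
      +-cong (+-cong (*-congˡ (moment₀-sym m (suc k)))
                     (*-cong (stay₀-sym k) (moment₀-sym m k)))
             (lower₀-sym k)
      where
      lower₀-sym : ∀ k → A.lower₀ (A.moment₀ m) k ≈ B.lower₀ (B.moment₀ m) k
      lower₀-sym zero    = refl
      lower₀-sym (suc k) = *-cong (*-comm (y + ι k) (x + ι k)) (moment₀-sym m k)

    moment-sym : ∀ m k → A.moment m k ≈ B.moment m k
    moment-sym zero    k = refl
    moment-sym (suc m) k =
      +-cong (+-cong (+-cong (*-congˡ (moment-sym m (suc k)))
                             (*-cong (stay-sym k) (moment-sym m k)))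
                     (lower-sym k))
             (*-cong (*-congʳ (*-comm x y)) (moment₀-sym m k))
      where
      lower-sym : ∀ k → A.lower (A.moment m) k ≈ B.lower (B.moment m) k
      lower-sym zero    = refl
      lower-sym (suc k) = *-cong (casimir-sym (suc k)) (moment-sym m k)

    total-sym : ∀ m → A.total m ≈ B.total m
    total-sym m = begin
      A.total m                                  ≈⟨ A.total-moments m ⟩
      d * A.moment m 0 + x * y * A.moment₀ m 0   ≈⟨ +-cong (*-congˡ (moment-sym m 0))
                                                      (*-cong (*-comm x y) (moment₀-sym m 0)) ⟩
      d * B.moment m 0 + y * x * B.moment₀ m 0   ≈⟨ B.total-moments m ⟨
      B.total m                                  ∎

-- Marked words

-- A cell (b , v) is the letter v together with a flag telling whether the
-- gap before v is open, that is, due to receive letters later; the gap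
-- after the last letter is always open.
Cell : Set
Cell = Bool × ℕ

Marked : Set
Marked = List Cell

bit : Bool → ℕ
bit b = if b then 1 else 0

letters : Marked → Word
letters = map proj₂

closed : Word → Marked
closed = map (false ,_)

-- The statistics are extended to marked words so as to count what is
-- already decided: an open gap is a descent into the next letter and an
-- ascent from the previous one, since only larger letters will enter it.
lrmaxFrom : ℕ → Marked → ℕ
lrmaxFrom m []              = 0
-- The open gap will receive a larger letter, so no letter now behind it ends as an LR-maximum.
lrmaxFrom m ((true  , v) ∷ u) = 0
lrmaxFrom m ((false , v) ∷ u) =
  if m <ᵇ v then suc (lrmaxFrom v u) else lrmaxFrom m u

lrmax : Word → ℕ
lrmax w = lrmaxFrom 0 (closed w)

-- An open gap before 1 will receive letters larger than v, which spoils an RL-maximum at v. The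
-- value at `[]` makes letters to the right of 1 contribute nothing.
dominates : ℕ → Marked → Bool
dominates v []              = false
dominates v ((true  , w) ∷ u) = false
dominates v ((false , w) ∷ u) =
  if w ≡ᵇ 1 then true else (w <ᵇ v) ∧ dominates v u

rlmᵐ : Marked → ℕ
rlmᵐ []            = 0
rlmᵐ ((b , v) ∷ u) = if v ≡ᵇ 1 then 0 else bit (dominates v u) ℕ.+ rlmᵐ u

desFrom : ℕ → Marked → ℕ
desFrom p []            = 0
desFrom p ((b , v) ∷ u) = bit (b ∨ (v <ᵇ p)) ℕ.+ desFrom v u

falls : ℕ → Marked → Bool
falls v []              = false
falls v ((true  , w) ∷ u) = false
falls v ((false , w) ∷ u) = w <ᵇ v

doubleFrom : ℕ → Marked → ℕ
doubleFrom p []            = 0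
doubleFrom p ((b , v) ∷ u) = bit ((b ∨ (v <ᵇ p)) ∧ falls v u) ℕ.+ doubleFrom v u

isMin : ℕ → Marked → Bool
isMin v u = does (all? (v ℕ.<?_) (letters u))

<⇒true : ∀ {m n} → m < n → (m <ᵇ n) ≡ true
<⇒true {m} {n} = dec-true (m ℕ.<? n)

≤⇒false : ∀ {m n} → n ≤ m → (m <ᵇ n) ≡ false
≤⇒false {m} {n} n≤m = dec-false (m ℕ.<? n) (ℕ.≤⇒≯ n≤m)

≢⇒false : ∀ {m n} → m ≢ n → (m ≡ᵇ n) ≡ false
≢⇒false {m} {n} = dec-false (m ℕ.≟ n)

openings : Marked → ℕ
openings []            = 0
openings ((b , v) ∷ u) = bit b ℕ.+ openings u

-- Open gaps to the left and to the right of the letter 1.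
openingsˡ : Marked → ℕ
openingsˡ []            = 0
openingsˡ ((b , v) ∷ u) = bit b ℕ.+ (if v ≡ᵇ 1 then 0 else openingsˡ u)

openingsʳ : Marked → ℕ
openingsʳ []            = 0
openingsʳ ((b , v) ∷ u) = if v ≡ᵇ 1 then openings u else openingsʳ u

isOpen : Marked → Bool
isOpen []            = false
isOpen ((b , v) ∷ u) = b ∨ isOpen u

Avoids1 : Marked → Set
Avoids1 = All ((_≢ 1) ∘ proj₂)

-- The letter 1 occurs exactly once, so that `openingsˡ` and `openingsʳ` together count all gaps
-- marked open.
data Contains1 : Marked → Set where
  here  : ∀ {b u} → Avoids1 u → Contains1 ((b , 1) ∷ u)
  there : ∀ {b v u} → v ≢ 1 → Contains1 u → Contains1 ((b , v) ∷ u)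

Below : ℕ → Marked → Set
Below N = All ((_< N) ∘ proj₂)

openingsˡ-ʳ++ : ∀ r u → Avoids1 r → openingsˡ (r ʳ++ u) ≡ openings r ℕ.+ openingsˡ u
openingsˡ-ʳ++ []            u []        = ≡.refl
openingsˡ-ʳ++ ((b , v) ∷ r) u (v≢1 ∷ r≢1)
  rewrite openingsˡ-ʳ++ r ((b , v) ∷ u) r≢1 | ≢⇒false v≢1
  | ≡.sym (ℕ.+-assoc (openings r) (bit b) (openingsˡ u))
  | ℕ.+-comm (openings r) (bit b) = ≡.refl

openingsʳ-ʳ++ : ∀ r u → Avoids1 r → openingsʳ (r ʳ++ u) ≡ openingsʳ u
openingsʳ-ʳ++ []            u []        = ≡.refl
openingsʳ-ʳ++ ((b , v) ∷ r) u (v≢1 ∷ r≢1)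
  rewrite openingsʳ-ʳ++ r ((b , v) ∷ u) r≢1 | ≢⇒false v≢1 = ≡.refl

-- Effect of inserting a new largest letter

module _ (N : ℕ) (1<N : 1 < N) where

  -- u′ is u with N inserted; the last three fields make this stable under
  -- prepending letters.
  record Grown (u′ u : Marked) (eˣ eʸ eᑫ eᵈ eᵗ : ℕ) : Set where
    field
      lrmax≡     : ∀ m → m < N → lrmaxFrom m u′ ≡ eˣ ℕ.+ lrmaxFrom m u
      rlmin≡     : rlmin (letters u′) ≡ eʸ ℕ.+ rlmin (letters u)
      rlm≡       : rlmᵐ u′ ≡ eᑫ ℕ.+ rlmᵐ u
      des≡       : ∀ p → p < N → desFrom p u′ ≡ eᵈ ℕ.+ desFrom p u
      double≡    : ∀ p → p < N → doubleFrom p u′ ≡ eᵗ ℕ.+ doubleFrom p u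
      isMin≡     : ∀ v → v < N → isMin v u′ ≡ isMin v u
      dominates≡ : ∀ v → v < N → dominates v u′ ≡ dominates v u
      falls≡     : ∀ v → v < N → falls v u′ ≡ falls v u

  open Grown

  -- An open gap in front cancels all LR-maxima behind it. The letter 1 cuts off the count in
  -- `rlmᵐ`, so the increment for rlm has to vanish when 1 is prepended.
  grown-∷ : ∀ {u′ u eˣ eʸ eᑫ eᵈ eᵗ} b v → v < N → (v ≡ 1 → eᑫ ≡ 0) →
            Grown u′ u eˣ eʸ eᑫ eᵈ eᵗ →
            Grown ((b , v) ∷ u′) ((b , v) ∷ u) (if b then 0 else eˣ) eʸ eᑫ eᵈ eᵗ
  grown-∷ {u′} {u} {eˣ} {eʸ} {eᑫ} {eᵈ} {eᵗ} b v v<N v≡1⇒ g = record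
    { lrmax≡     = lrmax-∷ b
    ; rlmin≡     = begin
        bit (isMin v u′) ℕ.+ rlmin (letters u′)
          ≡⟨ ≡.cong₂ ℕ._+_ (≡.cong bit (isMin≡ g v v<N)) (rlmin≡ g) ⟩
        bit (isMin v u) ℕ.+ (eʸ ℕ.+ rlmin (letters u))
          ≡⟨ x∙yz≈y∙xz (bit (isMin v u)) eʸ _ ⟩
        eʸ ℕ.+ (bit (isMin v u) ℕ.+ rlmin (letters u)) ∎
    ; rlm≡       = rlm-∷
    ; des≡       = λ p _ → ≡.trans (≡.cong (bit (b ∨ (v <ᵇ p)) ℕ.+_) (des≡ g v v<N))
                                 (x∙yz≈y∙xz (bit (b ∨ (v <ᵇ p))) eᵈ _)
    ; double≡    = λ p _ → ≡.trans
        (≡.cong₂ (λ f n → bit ((b ∨ (v <ᵇ p)) ∧ f) ℕ.+ n) (falls≡ g v v<N) (double≡ g v v<N))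
        (x∙yz≈y∙xz (bit ((b ∨ (v <ᵇ p)) ∧ falls v u)) eᵗ _)
    ; isMin≡     = λ w w<N → ≡.cong ((w <ᵇ v) ∧_) (isMin≡ g w w<N)
    ; dominates≡ = dominates-∷ b
    ; falls≡     = falls-∷ b
    }
    where
    open ≡.≡-Reasoning
    lrmax-∷ : ∀ b m → m < N → lrmaxFrom m ((b , v) ∷ u′) ≡
              (if b then 0 else eˣ) ℕ.+ lrmaxFrom m ((b , v) ∷ u)
    lrmax-∷ true  m m<N = ≡.refl
    lrmax-∷ false m m<N with m <ᵇ v
    ... | true  = ≡.trans (≡.cong suc (lrmax≡ g v v<N)) (≡.sym (ℕ.+-suc eˣ _))
    ... | false = lrmax≡ g m m<N
    rlm-∷ : rlmᵐ ((b , v) ∷ u′) ≡ eᑫ ℕ.+ rlmᵐ ((b , v) ∷ u)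
    rlm-∷ with v ℕ.≟ 1
    ... | yes ≡.refl = ≡.trans (≡.sym (v≡1⇒ ≡.refl)) (≡.sym (ℕ.+-identityʳ eᑫ))
    ... | no v≢1 rewrite ≢⇒false v≢1 = ≡.trans
      (≡.cong₂ (λ f n → bit f ℕ.+ n) (dominates≡ g v v<N) (rlm≡ g))
      (x∙yz≈y∙xz (bit (dominates v u)) eᑫ _)
    dominates-∷ : ∀ b w → w < N → dominates w ((b , v) ∷ u′) ≡ dominates w ((b , v) ∷ u)
    dominates-∷ true  w w<N = ≡.refl
    dominates-∷ false w w<N =
      ≡.cong (λ f → if v ≡ᵇ 1 then true else (v <ᵇ w) ∧ f) (dominates≡ g w w<N)
    falls-∷ : ∀ b w → w < N → falls w ((b , v) ∷ u′) ≡ falls w ((b , v) ∷ u)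
    falls-∷ true  w w<N = ≡.refl
    falls-∷ false w w<N = ≡.refl

  grown-ʳ++ : ∀ {u′ u eˣ eʸ eᑫ eᵈ eᵗ} r → Below N r →
              All (λ c → proj₂ c ≡ 1 → eᑫ ≡ 0) r →
              Grown u′ u eˣ eʸ eᑫ eᵈ eᵗ →
              Grown (r ʳ++ u′) (r ʳ++ u) (if isOpen r then 0 else eˣ) eʸ eᑫ eᵈ eᵗ
  grown-ʳ++ []               []          []           g = g
  grown-ʳ++ ((true , v) ∷ r) (v<N ∷ r<N) (v≡1⇒ ∷ r≡1⇒) g
    with grown-ʳ++ r r<N r≡1⇒ (grown-∷ true v v<N v≡1⇒ g)
  ... | g′ with isOpen r
  ... | true  = g′
  ... | false = g′
  grown-ʳ++ ((false , v) ∷ r) (v<N ∷ r<N) (v≡1⇒ ∷ r≡1⇒) g =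
    grown-ʳ++ r r<N r≡1⇒ (grown-∷ false v v<N v≡1⇒ g)

  lrmaxFrom-below : ∀ m u → All ((_≤ m) ∘ proj₂) u → lrmaxFrom m u ≡ 0
  lrmaxFrom-below m []                []          = ≡.refl
  lrmaxFrom-below m ((true  , v) ∷ u) _           = ≡.refl
  lrmaxFrom-below m ((false , v) ∷ u) (v≤m ∷ u≤m) rewrite ≤⇒false v≤m =
    lrmaxFrom-below m u u≤m

  N≢1 : N ≢ 1
  N≢1 ≡.refl = ℕ.<-irrefl ≡.refl 1<N

  -- At the end of the word N is a new RL-minimum, and the smaller letters before it keep their
  -- status.
  grown-end : ∀ b → Grown ((b , N) ∷ []) [] (bit (not b)) 1 0 (bit b) 0
  grown-end b = record
    { lrmax≡     = lm b
    ; rlmin≡     = ≡.refl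
    ; rlm≡       = rl b
    ; des≡       = ds b
    ; double≡    = double b
    ; isMin≡     = λ v v<N → ≡.cong (_∧ true) (<⇒true v<N)
    ; dominates≡ = dom b
    ; falls≡     = fall b
    }
    where
    lm : ∀ b m → m < N → lrmaxFrom m ((b , N) ∷ []) ≡ bit (not b) ℕ.+ 0
    lm true  m m<N = ≡.refl
    lm false m m<N rewrite <⇒true m<N = ≡.refl
    rl : ∀ b → rlmᵐ ((b , N) ∷ []) ≡ 0
    rl b rewrite ≢⇒false N≢1 = ≡.refl
    ds : ∀ b p → p < N → desFrom p ((b , N) ∷ []) ≡ bit b ℕ.+ 0
    ds true  p p<N = ≡.refl
    ds false p p<N rewrite ≤⇒false (ℕ.<⇒≤ p<N) = ≡.refl
    double : ∀ b p → p < N → doubleFrom p ((b , N) ∷ []) ≡ 0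
    double true  p p<N = ≡.refl
    double false p p<N rewrite ≤⇒false (ℕ.<⇒≤ p<N) = ≡.refl
    dom : ∀ b v → v < N → dominates v ((b , N) ∷ []) ≡ false
    dom true  v v<N = ≡.refl
    dom false v v<N rewrite ≢⇒false N≢1 | ≤⇒false (ℕ.<⇒≤ v<N) = ≡.refl
    fall : ∀ b v → v < N → falls v ((b , N) ∷ []) ≡ false
    fall true  v v<N = ≡.refl
    fall false v v<N = ≤⇒false (ℕ.<⇒≤ v<N)

  -- The flags b and c tell whether the left and right sides of N stay open. The old gap already
  -- counted a descent into v, which persists; an open left side adds a descent into N, and a closed
  -- right side then makes it part of a consecutive 321.
  grown-gap : ∀ b c v u → v < N → Below N u →
              Grown ((b , N) ∷ (c , v) ∷ u) ((true , v) ∷ u)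
                    (bit (not b)) 0 (bit (dominates N ((c , v) ∷ u)))
                    (bit b) (bit (b ∧ not c))
  grown-gap b c v u v<N u<N = record
    { lrmax≡     = lm b
    ; rlmin≡     = rmin
    ; rlm≡       = rl
    ; des≡       = ds b c
    ; double≡    = double b c
    ; isMin≡     = λ w w<N → ≡.cong (_∧ isMin w ((true , v) ∷ u)) (<⇒true w<N)
    ; dominates≡ = dom b
    ; falls≡     = fall b
    }
    where
    lm : ∀ b m → m < N → lrmaxFrom m ((b , N) ∷ (c , v) ∷ u) ≡ bit (not b) ℕ.+ 0
    lm true  m m<N = ≡.refl
    lm false m m<N rewrite <⇒true m<N =
      ≡.cong suc (lrmaxFrom-below N ((c , v) ∷ u) (ℕ.<⇒≤ v<N ∷ All.map ℕ.<⇒≤ u<N))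
    rmin : rlmin (N ∷ v ∷ letters u) ≡ rlmin (v ∷ letters u)
    rmin rewrite ≤⇒false (ℕ.<⇒≤ v<N) = ≡.refl
    rl : rlmᵐ ((b , N) ∷ (c , v) ∷ u) ≡
          bit (dominates N ((c , v) ∷ u)) ℕ.+ rlmᵐ ((true , v) ∷ u)
    rl rewrite ≢⇒false N≢1 = ≡.refl
    ds : ∀ b c p → p < N → desFrom p ((b , N) ∷ (c , v) ∷ u) ≡ bit b ℕ.+ suc (desFrom v u)
    ds b c p p<N rewrite ≤⇒false (ℕ.<⇒≤ p<N) | <⇒true v<N with b | c
    ... | true  | true  = ≡.refl
    ... | true  | false = ≡.refl
    ... | false | true  = ≡.refl
    ... | false | false = ≡.refl
    double : ∀ b c p → p < N → doubleFrom p ((b , N) ∷ (c , v) ∷ u) ≡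
             bit (b ∧ not c) ℕ.+ doubleFrom p ((true , v) ∷ u)
    double b c p p<N rewrite ≤⇒false (ℕ.<⇒≤ p<N) | <⇒true v<N with b | c
    ... | true  | true  = ≡.refl
    ... | true  | false rewrite <⇒true v<N = ≡.refl
    ... | false | true  = ≡.refl
    ... | false | false = ≡.refl
    dom : ∀ b w → w < N → dominates w ((b , N) ∷ (c , v) ∷ u) ≡ false
    dom true  w w<N = ≡.refl
    dom false w w<N rewrite ≢⇒false N≢1 | ≤⇒false (ℕ.<⇒≤ w<N) = ≡.refl
    fall : ∀ b w → w < N → falls w ((b , N) ∷ (c , v) ∷ u) ≡ false
    fall true  w w<N = ≡.refl
    fall false w w<N = ≤⇒false (ℕ.<⇒≤ w<N)

  dominates-avoids1 : ∀ u → Avoids1 u → dominates N u ≡ false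
  dominates-avoids1 []                []          = ≡.refl
  dominates-avoids1 ((true  , v) ∷ u) _           = ≡.refl
  dominates-avoids1 ((false , v) ∷ u) (v≢1 ∷ u≢1)
    rewrite ≢⇒false v≢1 | dominates-avoids1 u u≢1 with v <ᵇ N
  ... | true  = ≡.refl
  ... | false = ≡.refl

  -- Since N exceeds every letter present, only an open gap before 1 can spoil its RL-maximum.
  dominates-contains1 : ∀ u → Below N u → Contains1 u →
                        dominates N u ≡ (openingsˡ u ≡ᵇ 0)
  dominates-contains1 ((true  , _) ∷ u) _           _             = ≡.refl
  dominates-contains1 ((false , 1) ∷ u) _           (here _)      = ≡.refl
  dominates-contains1 ((false , v) ∷ u) (v<N ∷ u<N) (there v≢1 u∋1)
    rewrite ≢⇒false v≢1 | <⇒true v<N = dominates-contains1 u u<N u∋1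

-- Summation over marked words

module Sums {c ℓ} (S : CommutativeSemiring c ℓ) where
  open CommutativeSemiring S hiding (zero)
  open import Algebra.Solver.Ring.NaturalCoefficients.Default S
    using (solve; _:+_; _:=_)
  open import Relation.Binary.Reasoning.Setoid setoid

  ∑ : ∀ {a} {A : Set a} → List A → (A → Carrier) → Carrier
  ∑ xs f = foldr (λ x s → f x + s) 0# xs

  module _ {a} {A : Set a} where
    ∑-cong : (xs : List A) {f g : A → Carrier} →
             (∀ {x} → x ∈ xs → f x ≈ g x) → ∑ xs f ≈ ∑ xs g
    ∑-cong []       f≈g = refl
    ∑-cong (x ∷ xs) f≈g = +-cong (f≈g (here ≡.refl)) (∑-cong xs (λ x∈ → f≈g (there x∈)))

    ∑-+ : (xs : List A) (f g : A → Carrier) →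
          ∑ xs (λ x → f x + g x) ≈ ∑ xs f + ∑ xs g
    ∑-+ []       f g = sym (+-identityˡ 0#)
    ∑-+ (x ∷ xs) f g = trans (+-congˡ (∑-+ xs f g))
      (solve 4 (λ a b c e → a :+ b :+ (c :+ e) := a :+ c :+ (b :+ e)) refl
        (f x) (g x) (∑ xs f) (∑ xs g))

    ∑-*ˡ : (xs : List A) (s : Carrier) (f : A → Carrier) →
           ∑ xs (λ x → s * f x) ≈ s * ∑ xs f
    ∑-*ˡ []       s f = sym (zeroʳ s)
    ∑-*ˡ (x ∷ xs) s f = trans (+-congˡ (∑-*ˡ xs s f)) (sym (distribˡ s _ _))

    ∑-++ : (xs ys : List A) (f : A → Carrier) → ∑ (xs ++ ys) f ≈ ∑ xs f + ∑ ys f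
    ∑-++ []       ys f = sym (+-identityˡ _)
    ∑-++ (x ∷ xs) ys f = trans (+-congˡ (∑-++ xs ys f)) (sym (+-assoc _ _ _))

    ∑-map : ∀ {b} {B : Set b} (g : B → A) (xs : List B) (f : A → Carrier) →
            ∑ (map g xs) f ≡ ∑ xs (f ∘ g)
    ∑-map g []       f = ≡.refl
    ∑-map g (x ∷ xs) f = ≡.cong (f (g x) +_) (∑-map g xs f)

    ∑-concatMap : ∀ {b} {B : Set b} (g : B → List A) (xs : List B) (f : A → Carrier) →
                  ∑ (concatMap g xs) f ≈ ∑ xs (λ x → ∑ (g x) f)
    ∑-concatMap g []       f = refl
    ∑-concatMap g (x ∷ xs) f =
      trans (∑-++ (g x) (concatMap g xs) f) (+-congˡ (∑-concatMap g xs f))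

  -- Fixing the letters and summing over the flags lets the insertion recursion of `𝔖` act on plain
  -- words.
  markSum : (Marked → Carrier) → Word → Carrier
  markSum f []      = f []
  markSum f (v ∷ w) =
    markSum (λ u → f ((true , v) ∷ u)) w + markSum (λ u → f ((false , v) ∷ u)) w

  markSum-cong : ∀ {f g} w → (∀ u → letters u ≡ w → f u ≈ g u) → markSum f w ≈ markSum g w
  markSum-cong []      f≈g = f≈g [] ≡.refl
  markSum-cong (v ∷ w) f≈g = +-cong
    (markSum-cong w (λ u eq → f≈g ((true  , v) ∷ u) (≡.cong (v ∷_) eq)))
    (markSum-cong w (λ u eq → f≈g ((false , v) ∷ u) (≡.cong (v ∷_) eq)))

  markSum-+ : ∀ f g w → markSum (λ u → f u + g u) w ≈ markSum f w + markSum g w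
  markSum-+ f g []      = refl
  markSum-+ f g (v ∷ w) = trans
    (+-cong (markSum-+ _ _ w) (markSum-+ _ _ w))
    (solve 4 (λ a b c e → a :+ b :+ (c :+ e) := a :+ c :+ (b :+ e)) refl _ _ _ _)

  markSum-0# : ∀ {f} w → (∀ u → letters u ≡ w → f u ≈ 0#) → markSum f w ≈ 0#
  markSum-0# []      f≈0 = f≈0 [] ≡.refl
  markSum-0# (v ∷ w) f≈0 = trans (+-cong
    (markSum-0# w (λ u eq → f≈0 ((true  , v) ∷ u) (≡.cong (v ∷_) eq)))
    (markSum-0# w (λ u eq → f≈0 ((false , v) ∷ u) (≡.cong (v ∷_) eq))))
    (+-identityˡ 0#)

  markSum-closed : ∀ {f} w → (∀ u → letters u ≡ w → isOpen u ≡ true → f u ≈ 0#) →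
                   markSum f w ≈ f (closed w)
  markSum-closed []      f≈0 = refl
  markSum-closed (v ∷ w) f≈0 = trans (+-cong
    (markSum-0# w (λ u eq → f≈0 ((true  , v) ∷ u) (≡.cong (v ∷_) eq) ≡.refl))
    (markSum-closed w (λ u eq → f≈0 ((false , v) ∷ u) (≡.cong (v ∷_) eq))))
    (+-identityˡ _)

  -- The sum of f over the marked words obtained from r ʳ++ u by inserting
  -- N into one of the open gaps of u.
  growSum : ℕ → (Marked → Carrier) → Marked → Marked → Carrier
  growSum N f r []                = f (r ʳ++ ((true , N) ∷ [])) + f (r ʳ++ ((false , N) ∷ []))
  growSum N f r ((true  , v) ∷ u) =
    f (r ʳ++ ((true  , N) ∷ (true  , v) ∷ u)) + f (r ʳ++ ((false , N) ∷ (true  , v) ∷ u)) +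
    (f (r ʳ++ ((true  , N) ∷ (false , v) ∷ u)) + f (r ʳ++ ((false , N) ∷ (false , v) ∷ u))) +
    growSum N f ((true , v) ∷ r) u
  growSum N f r ((false , v) ∷ u) = growSum N f ((false , v) ∷ r) u

  -- Double counting: the place of N may be chosen before or after the flags of the remaining gaps.
  -- In the second order the gap receiving N must be open, and its two sides get new flags freely.
  ∑-insertions : ∀ N f r w →
    ∑ (insertions N w) (markSum (λ u → f (r ʳ++ u))) ≈ markSum (growSum N f r) w
  ∑-insertions N f r []      = +-identityʳ _
  ∑-insertions N f r (v ∷ w) = begin
    markSum (F true true) w + markSum (F true false) w +
    (markSum (F false true) w + markSum (F false false) w) +
    ∑ (map (v ∷_) (insertions N w)) (markSum (λ u → f (r ʳ++ u)))
      ≡⟨ ≡.cong (markSum (F true true) w + markSum (F true false) w +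
                 (markSum (F false true) w + markSum (F false false) w) +_)
                (∑-map (v ∷_) (insertions N w) _) ⟩
    markSum (F true true) w + markSum (F true false) w +
    (markSum (F false true) w + markSum (F false false) w) +
    ∑ (insertions N w) (λ w′ → markSum (λ u → f (((true , v) ∷ r) ʳ++ u)) w′ +
                               markSum (λ u → f (((false , v) ∷ r) ʳ++ u)) w′)
      ≈⟨ +-congˡ (trans (∑-+ (insertions N w) _ _)
           (+-cong (∑-insertions N f ((true , v) ∷ r) w)
                   (∑-insertions N f ((false , v) ∷ r) w))) ⟩
    markSum (F true true) w + markSum (F true false) w +
    (markSum (F false true) w + markSum (F false false) w) +
    (markSum (growSum N f ((true , v) ∷ r)) w + markSum (growSum N f ((false , v) ∷ r)) w)
      ≈⟨ solve 6 (λ a b c e g h → a :+ b :+ (c :+ e) :+ (g :+ h) :=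
                                  a :+ c :+ (b :+ e) :+ g :+ h) refl _ _ _ _ _ _ ⟩
    markSum (F true true) w + markSum (F false true) w +
    (markSum (F true false) w + markSum (F false false) w) +
    markSum (growSum N f ((true , v) ∷ r)) w + markSum (growSum N f ((false , v) ∷ r)) w
      ≈⟨ +-congʳ (trans
           (+-congʳ (trans
             (+-cong (sym (markSum-+ (F true true) (F false true) w))
                     (sym (markSum-+ (F true false) (F false false) w)))
             (sym (markSum-+ (λ u → F true true u + F false true u)
                             (λ u → F true false u + F false false u) w))))
           (sym (markSum-+ (λ u → F true true u + F false true u +
                                  (F true false u + F false false u))
                           (growSum N f ((true , v) ∷ r)) w))) ⟩
    markSum (growSum N f r) (v ∷ w) ∎
    where
    F : Bool → Bool → Marked → Carrier
    F b c u = f (r ʳ++ ((b , N) ∷ (c , v) ∷ u))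

-- One insertion as a step of the walk on numbers of open gaps

module HistorySums {c ℓ} (S : CommutativeSemiring c ℓ)
                   (x y q d t : CommutativeSemiring.Carrier S) where
  open CommutativeSemiring S hiding (zero)
  open import Algebra.Properties.Semiring.Exp semiring using (_^_; ^-homo-*)
  open import Algebra.Solver.Ring.NaturalCoefficients.Default S
    using (solve; _:+_; _:*_; _:=_; con)
  open import Relation.Binary.Reasoning.Setoid setoid
  open HistoryAlgebra S
  open Weighted x y q d t
  open Sums S

  monomial : ℕ → ℕ → ℕ → ℕ → ℕ → Carrier
  monomial eˣ eʸ eᑫ eᵈ eᵗ = x ^ eˣ * (y ^ eʸ * (q ^ eᑫ * (d ^ eᵈ * t ^ eᵗ)))

  weightᵐ : Marked → Carrier
  weightᵐ u =
    monomial (lrmaxFrom 0 u) (rlmin (letters u)) (rlmᵐ u) (desFrom 0 u) (doubleFrom 0 u)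

  monomial-+ : ∀ a b c e f a′ b′ c′ e′ f′ →
    monomial (a ℕ.+ a′) (b ℕ.+ b′) (c ℕ.+ c′) (e ℕ.+ e′) (f ℕ.+ f′) ≈
    monomial a′ b′ c′ e′ f′ * monomial a b c e f
  monomial-+ a b c e f a′ b′ c′ e′ f′ = trans
    (*-cong (^-homo-* x a a′) (*-cong (^-homo-* y b b′) (*-cong (^-homo-* q c c′)
      (*-cong (^-homo-* d e e′) (^-homo-* t f f′)))))
    (solve 10 (λ a b c e f a′ b′ c′ e′ f′ →
      (a :* a′) :* ((b :* b′) :* ((c :* c′) :* ((e :* e′) :* (f :* f′)))) :=
      (a′ :* (b′ :* (c′ :* (e′ :* f′)))) :* (a :* (b :* (c :* (e :* f))))) refl
      (x ^ a) (y ^ b) (q ^ c) (d ^ e) (t ^ f) (x ^ a′) (y ^ b′) (q ^ c′) (d ^ e′) (t ^ f′))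

  -- Indexed by the actual number of open gaps before 1, which `completions` shifts by one. The end
  -- of the word is not counted in b.
  continuations : ℕ → ℕ → ℕ → Carrier
  continuations m zero    b = completions₀ m b
  continuations m (suc i) b = completions m i b

  -- The weight already decided times that of all ways to insert m more letters; an insertion
  -- preserves the sum of these values.
  valueᵐ : ℕ → Marked → Carrier
  valueᵐ m u = weightᵐ u * continuations m (openingsˡ u) (openingsʳ u)

  -- first c is the weight of closing the left side of a gap, c telling
  -- whether there is an open gap before it; last n is the weight of closing
  -- the right side of a gap that precedes n further open gaps before 1.
  first : Bool → Carrier
  first c = if c then 1# else x

  last : ℕ → Carrier
  last n = if n ≡ᵇ 0 then q else 1#

  power-none : ∀ c → x ^ (if c then 0 else 0) ≈ 1#
  power-none true  = refl
  power-none false = refl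

  power-first : ∀ c → x ^ (if c then 0 else 1) ≈ first c
  power-first true  = refl
  power-first false = *-identityʳ x

  power-last : ∀ n → q ^ bit (n ≡ᵇ 0) ≈ last n
  power-last zero    = *-identityʳ q
  power-last (suc n) = refl

  monomial-valley : ∀ c → monomial (if c then 0 else 0) 0 0 1 0 ≈ d
  monomial-valley c = trans (*-congʳ (power-none c))
    (solve 1 (λ d → con 1 :* (con 1 :* (con 1 :* ((d :* con 1) :* con 1))) := d) refl d)

  monomial-ascent : ∀ c → monomial (if c then 0 else 1) 0 0 0 0 ≈ first c
  monomial-ascent c = trans (*-congʳ (power-first c))
    (solve 1 (λ a → a :* (con 1 :* (con 1 :* (con 1 :* con 1))) := a) refl (first c))

  monomial-descent : ∀ c e → monomial (if c then 0 else 0) 0 e 1 1 ≈ d * t * q ^ e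
  monomial-descent c e = trans (*-congʳ (power-none c))
    (solve 3 (λ d t l →
      con 1 :* (con 1 :* (l :* ((d :* con 1) :* (t :* con 1)))) := d :* t :* l) refl
      d t (q ^ e))

  monomial-peak : ∀ c e → monomial (if c then 0 else 1) 0 e 0 0 ≈ first c * q ^ e
  monomial-peak c e = trans (*-congʳ (power-first c))
    (solve 2 (λ a l → a :* (con 1 :* (l :* (con 1 :* con 1))) := a :* l) refl
      (first c) (q ^ e))

  monomial-end-valley : ∀ c → monomial (if c then 0 else 0) 1 0 1 0 ≈ y * d
  monomial-end-valley c = trans (*-congʳ (power-none c))
    (solve 2 (λ y d →
      con 1 :* ((y :* con 1) :* (con 1 :* ((d :* con 1) :* con 1))) := y :* d) refl y d)

  monomial-end-ascent : ∀ c → monomial (if c then 0 else 1) 1 0 0 0 ≈ first c * y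
  monomial-end-ascent c = trans (*-congʳ (power-first c))
    (solve 2 (λ a y →
      a :* ((y :* con 1) :* (con 1 :* (con 1 :* con 1))) := a :* y) refl (first c) y)

  isPositive : ℕ → Bool
  isPositive n = not (n ≡ᵇ 0)

  -- The weight of inserting into the last n open gaps after 1 or at the end, where b counts all
  -- gaps marked open after 1 and c is as in `first`. The summands of an inner gap close neither
  -- side, the left, the right, and both.
  rightSum : (ℕ → Carrier) → ℕ → Bool → ℕ → Carrier
  rightSum f b c zero    = y * d * f (suc b) + first c * y * f b
  rightSum f b c (suc n) =
    d * f (suc b) + first c * f b + (d * t * f b + first c * f (pred b)) +
    rightSum f b true n

  leftSum : (ℕ → Carrier) → ℕ → Bool → ℕ → Carrier
  leftSum f a c zero    = 0#
  leftSum f a c (suc n) =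
    d * f (suc a) + first c * f a + (d * t * last n * f a + first c * last n * f (pred a)) +
    leftSum f a true n

  -- r lies to the left of u, in reverse order, and contains the letter 1.
  LeftPart : Marked → ℕ → ℕ → Set
  LeftPart r a b₀ = ∀ u → Avoids1 u →
    openingsˡ (r ʳ++ u) ≡ a × openingsʳ (r ʳ++ u) ≡ b₀ ℕ.+ openings u

  leftPart-∷ : ∀ {r a b₀} b v → v ≢ 1 → LeftPart r a b₀ →
               LeftPart ((b , v) ∷ r) a (b₀ ℕ.+ bit b)
  leftPart-∷ {b₀ = b₀} b v v≢1 left u u≢1 with left ((b , v) ∷ u) (v≢1 ∷ u≢1)
  ... | eqˡ , eqʳ = eqˡ , ≡.trans eqʳ (≡.sym (ℕ.+-assoc b₀ (bit b) (openings u)))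

  leftPart-1 : ∀ {r} b → Avoids1 r → LeftPart ((b , 1) ∷ r) (openings r ℕ.+ bit b) 0
  leftPart-1 {r} b r≢1 u u≢1 =
    ≡.trans (openingsˡ-ʳ++ r ((b , 1) ∷ u) r≢1)
            (≡.cong (openings r ℕ.+_) (ℕ.+-identityʳ (bit b))) ,
    openingsʳ-ʳ++ r ((b , 1) ∷ u) r≢1

  module _ (m N : ℕ) (1<N : 1 < N) where

    N≢1′ : N ≢ 1
    N≢1′ = N≢1 N 1<N

    value-grown : ∀ {u′ u eˣ eʸ eᑫ eᵈ eᵗ a b} → Grown N 1<N u′ u eˣ eʸ eᑫ eᵈ eᵗ →
      openingsˡ u′ ≡ a → openingsʳ u′ ≡ b →
      valueᵐ m u′ ≈ weightᵐ u * (monomial eˣ eʸ eᑫ eᵈ eᵗ * continuations m a b)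
    value-grown {u′} {u} {eˣ} {eʸ} {eᑫ} {eᵈ} {eᵗ} g ≡.refl ≡.refl = trans
      (*-congʳ (trans (reflexive weight≡)
        (monomial-+ eˣ eʸ eᑫ eᵈ eᵗ _ _ _ _ _)))
      (*-assoc _ _ _)
      where
      open Grown g
      0<N : 0 < N
      0<N = ℕ.<-trans (s≤s z≤n) 1<N
      weight≡ : weightᵐ u′ ≡ monomial (eˣ ℕ.+ lrmaxFrom 0 u) (eʸ ℕ.+ rlmin (letters u))
                  (eᑫ ℕ.+ rlmᵐ u) (eᵈ ℕ.+ desFrom 0 u) (eᵗ ℕ.+ doubleFrom 0 u)
      weight≡ rewrite lrmax≡ 0 0<N | rlmin≡ | rlm≡ | des≡ 0 0<N | double≡ 0 0<N = ≡.refl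

    private
      avoids⇒ : ∀ {r e} → Avoids1 r → All (λ c → proj₂ c ≡ 1 → e ≡ 0) r
      avoids⇒ = All.map (λ v≢1 v≡1 → contradiction v≡1 v≢1)

      zero⇒ : ∀ {r : Marked} → All (λ c → proj₂ c ≡ 1 → 0 ≡ 0) r
      zero⇒ = All.tabulate (λ _ _ → ≡.refl)

    value-right : ∀ {r a b₀} b c v u → LeftPart r a b₀ → Below N r →
      v < N → Below N u → v ≢ 1 → Avoids1 u →
      valueᵐ m (r ʳ++ ((b , N) ∷ (c , v) ∷ u)) ≈ weightᵐ (r ʳ++ ((true , v) ∷ u)) *
        (monomial (if isOpen r then 0 else bit (not b)) 0 0 (bit b) (bit (b ∧ not c)) *
         continuations m a (b₀ ℕ.+ (bit b ℕ.+ (bit c ℕ.+ openings u))))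
    value-right {r} b c v u left r<N v<N u<N v≢1 u≢1 = value-grown
      (grown-ʳ++ N 1<N r r<N zero⇒ base)
      (proj₁ (left _ (N≢1′ ∷ v≢1 ∷ u≢1))) (proj₂ (left _ (N≢1′ ∷ v≢1 ∷ u≢1)))
      where
      base : Grown N 1<N ((b , N) ∷ (c , v) ∷ u) ((true , v) ∷ u)
               (bit (not b)) 0 0 (bit b) (bit (b ∧ not c))
      base = ≡.subst
        (λ f → Grown N 1<N ((b , N) ∷ (c , v) ∷ u) ((true , v) ∷ u)
                 (bit (not b)) 0 (bit f) (bit b) (bit (b ∧ not c)))
        (dominates-avoids1 N 1<N ((c , v) ∷ u) (v≢1 ∷ u≢1))
        (grown-gap N 1<N b c v u v<N u<N)

    value-end : ∀ {r a b₀} b → LeftPart r a b₀ → Below N r →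
      valueᵐ m (r ʳ++ ((b , N) ∷ [])) ≈ weightᵐ (r ʳ++ []) *
        (monomial (if isOpen r then 0 else bit (not b)) 1 0 (bit b) 0 *
         continuations m a (b₀ ℕ.+ (bit b ℕ.+ 0)))
    value-end {r} b left r<N = value-grown
      (grown-ʳ++ N 1<N r r<N zero⇒ (grown-end N 1<N b))
      (proj₁ (left _ (N≢1′ ∷ []))) (proj₂ (left _ (N≢1′ ∷ [])))

    value-left : ∀ {r} b c v u → Avoids1 r → Below N r →
      v < N → Below N u → Contains1 ((c , v) ∷ u) →
      valueᵐ m (r ʳ++ ((b , N) ∷ (c , v) ∷ u)) ≈ weightᵐ (r ʳ++ ((true , v) ∷ u)) *
        (monomial (if isOpen r then 0 else bit (not b)) 0
                  (bit (openingsˡ ((c , v) ∷ u) ≡ᵇ 0)) (bit b) (bit (b ∧ not c)) *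
         continuations m (openings r ℕ.+ (bit b ℕ.+ openingsˡ ((c , v) ∷ u)))
                         (openingsʳ ((c , v) ∷ u)))
    value-left {r} b c v u r≢1 r<N v<N u<N ∋1 = value-grown
      (grown-ʳ++ N 1<N r r<N (avoids⇒ r≢1) base) eqˡ eqʳ
      where
      base : Grown N 1<N ((b , N) ∷ (c , v) ∷ u) ((true , v) ∷ u)
               (bit (not b)) 0 (bit (openingsˡ ((c , v) ∷ u) ≡ᵇ 0)) (bit b) (bit (b ∧ not c))
      base = ≡.subst
        (λ f → Grown N 1<N ((b , N) ∷ (c , v) ∷ u) ((true , v) ∷ u)
                 (bit (not b)) 0 (bit f) (bit b) (bit (b ∧ not c)))
        (dominates-contains1 N 1<N ((c , v) ∷ u) (v<N ∷ u<N) ∋1)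
        (grown-gap N 1<N b c v u v<N u<N)
      eqˡ : openingsˡ (r ʳ++ ((b , N) ∷ (c , v) ∷ u)) ≡
            openings r ℕ.+ (bit b ℕ.+ openingsˡ ((c , v) ∷ u))
      eqˡ rewrite openingsˡ-ʳ++ r ((b , N) ∷ (c , v) ∷ u) r≢1 | ≢⇒false N≢1′ = ≡.refl
      eqʳ : openingsʳ (r ʳ++ ((b , N) ∷ (c , v) ∷ u)) ≡ openingsʳ ((c , v) ∷ u)
      eqʳ rewrite openingsʳ-ʳ++ r ((b , N) ∷ (c , v) ∷ u) r≢1 | ≢⇒false N≢1′ = ≡.refl

    collect : ∀ w {a₁ a₂ a₃ a₄ a₅ b₁ b₂ b₃ b₄ b₅} →
      a₁ ≈ w * b₁ → a₂ ≈ w * b₂ → a₃ ≈ w * b₃ → a₄ ≈ w * b₄ → a₅ ≈ w * b₅ →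
      a₁ + a₂ + (a₃ + a₄) + a₅ ≈ w * (b₁ + b₂ + (b₃ + b₄) + b₅)
    collect w p₁ p₂ p₃ p₄ p₅ = trans
      (+-cong (+-cong (+-cong p₁ p₂) (+-cong p₃ p₄)) p₅)
      (solve 6 (λ w a b c e f → w :* a :+ w :* b :+ (w :* c :+ w :* e) :+ w :* f :=
                                w :* (a :+ b :+ (c :+ e) :+ f)) refl _ _ _ _ _ _)

    -- As the scan moves right, every open gap contributes one block of `rightSum`; b₀ counts the
    -- open gaps after 1 already passed.
    growSum-right : ∀ {r a b₀ b} u → LeftPart r a b₀ → Below N r → Below N u → Avoids1 u →
      b₀ ℕ.+ openings u ≡ b →
      growSum N (valueᵐ m) r u ≈
      weightᵐ (r ʳ++ u) * rightSum (continuations m a) b (isOpen r) (openings u)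
    growSum-right {r} {a} {b₀} [] left r<N [] [] ≡.refl = begin
      valueᵐ m (r ʳ++ ((true , N) ∷ [])) + valueᵐ m (r ʳ++ ((false , N) ∷ []))
        ≈⟨ +-cong (value-end true left r<N) (value-end false left r<N) ⟩
      W * (monomial (if isOpen r then 0 else 0) 1 0 1 0 * f (b₀ ℕ.+ 1)) +
      W * (monomial (if isOpen r then 0 else 1) 1 0 0 0 * f (b₀ ℕ.+ 0))
        ≈⟨ distribˡ W _ _ ⟨
      W * (monomial (if isOpen r then 0 else 0) 1 0 1 0 * f (b₀ ℕ.+ 1) +
           monomial (if isOpen r then 0 else 1) 1 0 0 0 * f (b₀ ℕ.+ 0))
        ≈⟨ *-congˡ (+-cong
             (*-cong (monomial-end-valley (isOpen r)) (reflexive (≡.cong f (ℕ.+-suc b₀ 0))))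
             (*-congʳ (monomial-end-ascent (isOpen r)))) ⟩
      W * rightSum f (b₀ ℕ.+ 0) (isOpen r) 0 ∎
      where
      W = weightᵐ (r ʳ++ [])
      f = continuations m a
    growSum-right {r} {b₀ = b₀} ((false , v) ∷ u) left r<N (v<N ∷ u<N) (v≢1 ∷ u≢1) b≡ =
      growSum-right u (leftPart-∷ {r} false v v≢1 left) (v<N ∷ r<N) u<N u≢1
        (≡.trans (≡.cong (ℕ._+ openings u) (ℕ.+-identityʳ b₀)) b≡)
    growSum-right {r} {a} {b₀} ((true , v) ∷ u) left r<N (v<N ∷ u<N) (v≢1 ∷ u≢1) ≡.refl =
      collect W
        (trans (val true true) (*-congˡ (*-cong (monomial-valley (isOpen r))
          (reflexive (≡.cong f (ℕ.+-suc b₀ _))))))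
        (trans (val false true) (*-congˡ (*-congʳ (monomial-ascent (isOpen r)))))
        (trans (val true false) (*-congˡ (*-congʳ
          (trans (monomial-descent (isOpen r) 0) (*-identityʳ _)))))
        (trans (val false false) (*-congˡ (*-cong (monomial-ascent (isOpen r))
          (reflexive (≡.cong f (≡.sym (≡.cong pred (ℕ.+-suc b₀ _))))))))
        (growSum-right u (leftPart-∷ {r} true v v≢1 left) (v<N ∷ r<N) u<N u≢1
          (ℕ.+-assoc b₀ 1 _))
      where
      W = weightᵐ (r ʳ++ ((true , v) ∷ u))
      f = continuations m a
      val = λ b c → value-right b c v u left r<N v<N u<N v≢1 u≢1

    -- Shared by the gap directly before 1 and the earlier ones; n counts the open gaps that still
    -- follow before 1, and R stands for the insertions after 1.
    gap-left : ∀ {r n a b R} v u → Avoids1 r → Below N r → v < N → Below N u →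
      (∀ c → Contains1 ((c , v) ∷ u)) →
      (if v ≡ᵇ 1 then 0 else openingsˡ u) ≡ n →
      openings r ℕ.+ suc n ≡ a → openingsʳ ((true , v) ∷ u) ≡ b →
      growSum N (valueᵐ m) ((true , v) ∷ r) u ≈ weightᵐ (r ʳ++ ((true , v) ∷ u)) *
        (leftSum (λ i → continuations m i b) a true n + R) →
      growSum N (valueᵐ m) r ((true , v) ∷ u) ≈ weightᵐ (r ʳ++ ((true , v) ∷ u)) *
        (leftSum (λ i → continuations m i b) a (isOpen r) (suc n) + R)
    gap-left {r} {n} v u r≢1 r<N v<N u<N ∋1 ≡.refl ≡.refl ≡.refl ih = trans
      (collect W
        (trans (val true true) (*-congˡ (*-cong (monomial-valley (isOpen r))
          (reflexive (≡.cong f (ℕ.+-suc (openings r) _))))))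
        (trans (val false true) (*-congˡ (*-congʳ (monomial-ascent (isOpen r)))))
        (trans (val true false) (*-congˡ (*-congʳ
          (trans (monomial-descent (isOpen r) (bit (n ≡ᵇ 0))) (*-congˡ (power-last n))))))
        (trans (val false false) (*-congˡ (*-cong
          (trans (monomial-peak (isOpen r) (bit (n ≡ᵇ 0))) (*-congˡ (power-last n)))
          (reflexive (≡.cong f (≡.sym (≡.cong pred (ℕ.+-suc (openings r) _))))))))
        ih)
      (*-congˡ (sym (+-assoc _ _ _)))
      where
      W = weightᵐ (r ʳ++ ((true , v) ∷ u))
      f = λ i → continuations m i (openingsʳ ((true , v) ∷ u))
      val = λ b c → value-left b c v u r≢1 r<N v<N u<N (∋1 c)

    growSum-left : ∀ {r a b} u → Avoids1 r → Below N r → Below N u → Contains1 u →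
      openings r ℕ.+ openingsˡ u ≡ a → openingsʳ u ≡ b →
      growSum N (valueᵐ m) r u ≈ weightᵐ (r ʳ++ u) *
        (leftSum (λ i → continuations m i b) a (isOpen r) (openingsˡ u) +
         rightSum (continuations m a) b (isOpen r ∨ isPositive (openingsˡ u)) b)
    growSum-left {r} ((false , 1) ∷ u) r≢1 r<N (1<N ∷ u<N) (here u≢1) ≡.refl ≡.refl =
      trans (growSum-right u (leftPart-1 {r} false r≢1) (1<N ∷ r<N) u<N u≢1 ≡.refl)
        (*-congˡ (trans
          (reflexive (≡.cong
            (λ c → rightSum (continuations m (openings r ℕ.+ 0)) (openings u) c (openings u))
            (≡.sym (∨-identityʳ (isOpen r)))))
          (sym (+-identityˡ _))))
    growSum-left {r} ((true , 1) ∷ u) r≢1 r<N (1<N ∷ u<N) (here u≢1) ≡.refl ≡.refl =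
      trans
        (gap-left {r} 1 u r≢1 r<N 1<N u<N (λ _ → here u≢1) ≡.refl ≡.refl ≡.refl
          (trans (growSum-right u (leftPart-1 {r} true r≢1) (1<N ∷ r<N) u<N u≢1 ≡.refl)
                 (*-congˡ (sym (+-identityˡ _)))))
        (*-congˡ (+-congˡ (reflexive (≡.cong
          (λ c → rightSum (continuations m (openings r ℕ.+ 1)) (openings u) c (openings u))
          (≡.sym (∨-zeroʳ (isOpen r)))))))
    growSum-left {r} ((false , v) ∷ u) r≢1 r<N (v<N ∷ u<N) (there v≢1 u∋1) ≡.refl ≡.refl
      rewrite ≢⇒false v≢1 =
      growSum-left u (v≢1 ∷ r≢1) (v<N ∷ r<N) u<N u∋1 ≡.refl ≡.refl
    growSum-left {r} ((true , v) ∷ u) r≢1 r<N (v<N ∷ u<N) (there v≢1 u∋1) ≡.refl ≡.refl = trans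
      (gap-left {r} v u r≢1 r<N v<N u<N (λ _ → there v≢1 u∋1) v-eq
        (≡.cong (λ n → openings r ℕ.+ suc n) (≡.sym v-eq)) v-eqʳ
        (growSum-left u (v≢1 ∷ r≢1) (v<N ∷ r<N) u<N u∋1
          (≡.trans (≡.sym (ℕ.+-suc (openings r) _))
                   (≡.cong (λ n → openings r ℕ.+ suc n) (≡.sym v-eq)))
          ≡.refl))
      (*-congˡ (reflexive conclusion))
      where
      a b : ℕ
      a = openings r ℕ.+ openingsˡ ((true , v) ∷ u)
      b = openingsʳ ((true , v) ∷ u)
      v-eq : (if v ≡ᵇ 1 then 0 else openingsˡ u) ≡ openingsˡ u
      v-eq rewrite ≢⇒false v≢1 = ≡.refl
      v-eqʳ : openingsʳ ((true , v) ∷ u) ≡ openingsʳ u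
      v-eqʳ rewrite ≢⇒false v≢1 = ≡.refl
      conclusion :
        leftSum (λ i → continuations m i (openingsʳ u)) a (isOpen r) (suc (openingsˡ u)) +
        rightSum (continuations m a) (openingsʳ u) true (openingsʳ u) ≡
        leftSum (λ i → continuations m i b) a (isOpen r) (openingsˡ ((true , v) ∷ u)) +
        rightSum (continuations m a) b
          (isOpen r ∨ isPositive (openingsˡ ((true , v) ∷ u))) b
      conclusion rewrite v-eq | v-eqʳ | ∨-zeroʳ (isOpen r) = ≡.refl

  -- The factor `ι b` vanishes at 0, which absorbs the default `pred 0 = 0`.
  fallʳ-pred : ∀ f i b → fallʳ f i b ≈ ι b * f i (pred b)
  fallʳ-pred f i zero    = sym (zeroˡ _)
  fallʳ-pred f i (suc b) = refl

  -- Behind another open gap no insertion gives an LR-maximum, so the inner gaps all weigh the same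
  -- and only the end differs.
  rightSum-true : ∀ f b n → rightSum f b true n ≈
    ι n * (d * f (suc b) + f b + d * t * f b + f (pred b)) + y * (d * f (suc b) + f b)
  rightSum-true f b zero =
    solve 6 (λ y d t f g h → y :* d :* g :+ con 1 :* y :* f :=
      con 0 :* (d :* g :+ f :+ d :* t :* f :+ h) :+ y :* (d :* g :+ f)) refl
      y d t (f b) (f (suc b)) (f (pred b))
  rightSum-true f b (suc n) = trans (+-congˡ (rightSum-true f b n))
    (solve 7 (λ y d t k f g h →
      d :* g :+ con 1 :* f :+ (d :* t :* f :+ con 1 :* h) :+
      (k :* (d :* g :+ f :+ d :* t :* f :+ h) :+ y :* (d :* g :+ f)) :=
      (con 1 :+ k) :* (d :* g :+ f :+ d :* t :* f :+ h) :+ y :* (d :* g :+ f)) refl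
      y d t (ι n) (f b) (f (suc b)) (f (pred b)))

  -- All these gaps weigh the same except the last one before 1, whose right side carries q.
  leftSum-true : ∀ f a n → leftSum f a true (suc n) ≈
    ι (suc n) * (d * f (suc a) + f a) + (q + ι n) * (d * t * f a + f (pred a))
  leftSum-true f a zero =
    solve 6 (λ q d t f g h →
      d :* g :+ con 1 :* f :+ (d :* t :* q :* f :+ con 1 :* q :* h) :+ con 0 :=
      (con 1 :+ con 0) :* (d :* g :+ f) :+ (q :+ con 0) :* (d :* t :* f :+ h)) refl
      q d t (f a) (f (suc a)) (f (pred a))
  leftSum-true f a (suc n) = trans (+-congˡ (leftSum-true f a n))
    (solve 7 (λ q d t k f g h →
      d :* g :+ con 1 :* f :+ (d :* t :* con 1 :* f :+ con 1 :* con 1 :* h) :+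
      ((con 1 :+ k) :* (d :* g :+ f) :+ (q :+ k) :* (d :* t :* f :+ h)) :=
      (con 1 :+ (con 1 :+ k)) :* (d :* g :+ f) :+
      (q :+ (con 1 :+ k)) :* (d :* t :* f :+ h)) refl
      q d t (ι n) (f a) (f (suc a)) (f (pred a)))

  -- The cases are those of the recurrences: with no open gap before 1 the first gap lies after 1;
  -- with exactly one it is both first and last, giving `x * q`; with more, these two roles
  -- separate.
  continuations-suc : ∀ m a b →
    leftSum (λ i → continuations m i b) a false a +
    rightSum (continuations m a) b (isPositive a) b ≈ continuations (suc m) a b
  continuations-suc m zero zero =
    solve 5 (λ x y d f g →
      con 0 :+ (y :* d :* g :+ x :* y :* f) :=
      d :* ((y :+ con 0) :* g) :+ x :* y :* f :+ con 0) refl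
      x y d (completions₀ m 0) (completions₀ m 1)
  continuations-suc m zero (suc b) = trans
    (+-congˡ (+-congˡ (rightSum-true (completions₀ m) (suc b) b)))
    (solve 8 (λ x y d t k f g h →
      con 0 :+ (d :* g :+ x :* f :+ (d :* t :* f :+ x :* h) :+
        (k :* (d :* g :+ f :+ d :* t :* f :+ h) :+ y :* (d :* g :+ f))) :=
      d :* ((y :+ (con 1 :+ k)) :* g) :+ (x :+ y :+ k :+ d :* t :* (con 1 :+ k)) :* f :+
      (x :+ k) :* h) refl
      x y d t (ι b) (completions₀ m (suc b)) (completions₀ m (suc (suc b))) (completions₀ m b))
  continuations-suc m (suc zero) b = trans
    (+-congˡ (rightSum-true (completions m 0) b b))
    (trans
      (solve 11 (λ x y q d t k f g e h v →
        d :* e :+ x :* f :+ (d :* t :* q :* f :+ x :* q :* v) :+ con 0 :+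
        (k :* (d :* g :+ f :+ d :* t :* f :+ h) :+ y :* (d :* g :+ f)) :=
        d :* ((con 1 :+ con 0) :* e :+ (y :+ k) :* g) :+
        (x :+ y :+ k :+ d :* t :* (q :+ k)) :* f :+ (con 0 :+ k :* h) :+ x :* q :* v) refl
        x y q d t (ι b) (completions m 0 b) (completions m 0 (suc b)) (completions m 1 b)
        (completions m 0 (pred b)) (completions₀ m b))
      (+-congʳ (+-congˡ (+-congˡ (sym (fallʳ-pred (completions m) 0 b))))))
  continuations-suc m (suc (suc i)) b = trans
    (+-cong (+-congˡ (leftSum-true (λ i → continuations m i b) (suc (suc i)) i))
            (rightSum-true (completions m (suc i)) b b))
    (trans
      (solve 12 (λ x y q d t k l f g e h v →
        d :* e :+ x :* f :+ (d :* t :* con 1 :* f :+ x :* con 1 :* v) :+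
        ((con 1 :+ l) :* (d :* e :+ f) :+ (q :+ l) :* (d :* t :* f :+ v)) :+
        (k :* (d :* g :+ f :+ d :* t :* f :+ h) :+ y :* (d :* g :+ f)) :=
        d :* ((con 1 :+ (con 1 :+ l)) :* e :+ (y :+ k) :* g) :+
        (x :+ y :+ (con 1 :+ (l :+ k)) :+ d :* t :* (q :+ (con 1 :+ (l :+ k)))) :* f :+
        ((x :+ q :+ l) :* v :+ k :* h) :+ x :* q :* con 0) refl
        x y q d t (ι b) (ι i) (completions m (suc i) b) (completions m (suc i) (suc b))
        (completions m (suc (suc i)) b) (completions m (suc i) (pred b)) (completions m i b))
      (+-congʳ (+-cong
        (+-congˡ (*-congʳ (+-cong (+-congˡ (+-congˡ (sym (ι-+ i b))))
                                  (*-congˡ (+-congˡ (+-congˡ (sym (ι-+ i b))))))))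
        (+-congˡ (sym (fallʳ-pred (completions m) (suc i) b))))))

-- Letters of permutations

𝔖⇒↭ : ∀ n {w} → w ∈ 𝔖 n → w ↭ [1⋯ n ]
𝔖⇒↭ n = Equivalence.to (𝔖-complete n)

𝔖-letters : ∀ n {w} → w ∈ 𝔖 n → All (λ v → 1 ≤ v × v ≤ n) w
𝔖-letters n w∈ = All-resp-↭ (↭-sym (𝔖⇒↭ n w∈))
  (All.applyUpTo⁺₁ suc n (λ i<n → s≤s z≤n , i<n))

𝔖-distinct : ∀ n {w} → w ∈ 𝔖 n → Unique w
𝔖-distinct n w∈ = Setoid↭.Unique-resp-↭ (≡.setoid ℕ) (↭⇒↭ₛ (↭-sym (𝔖⇒↭ n w∈)))
  (Unique.applyUpTo⁺₁ suc n (λ i<j _ eq → ℕ.<⇒≢ i<j (ℕ.suc-injective eq)))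

𝔖-∋1 : ∀ n {w} → w ∈ 𝔖 (suc n) → 1 ∈ w
𝔖-∋1 n w∈ = ∈-resp-↭ (↭-sym (𝔖⇒↭ (suc n) w∈)) (here ≡.refl)

contains1 : ∀ u → Unique (letters u) → 1 ∈ letters u → Contains1 u
contains1 ((b , 1) ∷ u) (1∉ ∷ _) (here ≡.refl) =
  here (All.map (λ 1≢v v≡1 → 1≢v (≡.sym v≡1)) (All.map⁻ 1∉))
contains1 ((b , v) ∷ u) (v∉ ∷ u!) (there 1∈) =
  there (All.lookup v∉ 1∈) (contains1 u u! 1∈)

-- From weighted histories to sums over permutations

module Transfer {c ℓ} (S : CommutativeSemiring c ℓ)
                (x y q d t : CommutativeSemiring.Carrier S) where
  open CommutativeSemiring S hiding (zero)
  open import Algebra.Solver.Ring.NaturalCoefficients.Default S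
    using (solve; _:+_; _:*_; _:=_; con)
  open import Relation.Binary.Reasoning.Setoid setoid
  open HistoryAlgebra S
  open Weighted x y q d t
  open Sums S
  open HistorySums S x y q d t

  growSum-value : ∀ m n {w} → w ∈ 𝔖 (suc n) → ∀ u → letters u ≡ w →
    valueᵐ (suc m) u ≈ growSum (suc (suc n)) (valueᵐ m) [] u
  growSum-value m n w∈ u ≡.refl = sym (trans
    (growSum-left m (suc (suc n)) (s≤s (s≤s z≤n)) u [] []
      (All.map (s≤s ∘ proj₂) (All.map⁻ (𝔖-letters (suc n) w∈)))
      (contains1 u (𝔖-distinct (suc n) w∈) (𝔖-∋1 n w∈)) ≡.refl ≡.refl)
    (*-congˡ (continuations-suc m (openingsˡ u) (openingsʳ u))))

  -- With no letter left to insert, an open gap cannot be completed.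
  continuations-open : ∀ u → Contains1 u → isOpen u ≡ true →
    continuations 0 (openingsˡ u) (openingsʳ u) ≈ 0#
  continuations-open ((true  , v) ∷ u) _         _  = refl
  continuations-open ((false , 1) ∷ u) (here _)  eq = open-right u eq
    where
    open-right : ∀ u → isOpen u ≡ true → completions₀ 0 (openings u) ≈ 0#
    open-right ((true  , v) ∷ u) _  = refl
    open-right ((false , v) ∷ u) eq = open-right u eq
  continuations-open ((false , v) ∷ u) (there v≢1 u∋1) eq rewrite ≢⇒false v≢1 =
    continuations-open u u∋1 eq

  continuations-closed : ∀ w →
    continuations 0 (openingsˡ (closed w)) (openingsʳ (closed w)) ≈ 1#
  continuations-closed []      = refl
  continuations-closed (v ∷ w) with v ≡ᵇ 1
  ... | true  = closed-right w
    where
    closed-right : ∀ w → completions₀ 0 (openings (closed w)) ≈ 1#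
    closed-right []      = refl
    closed-right (_ ∷ w) = closed-right w
  ... | false = continuations-closed w

  -- Each insertion trades one of the m pending letters for a longer word without changing the sum;
  -- at m = 0 only the fully closed markings survive.
  ∑-𝔖-value : ∀ m n → ∑ (𝔖 (suc n)) (markSum (valueᵐ m)) ≈
                      ∑ (𝔖 (suc (n ℕ.+ m))) (λ w → weightᵐ (closed w))
  ∑-𝔖-value zero n rewrite ℕ.+-identityʳ n = ∑-cong (𝔖 (suc n)) λ {w} w∈ → trans
    (markSum-closed w λ { u ≡.refl open-u → trans
      (*-congˡ (continuations-open u
        (contains1 u (𝔖-distinct (suc n) w∈) (𝔖-∋1 n w∈)) open-u))
      (zeroʳ _) })
    (trans (*-congˡ (continuations-closed w)) (*-identityʳ _))
  ∑-𝔖-value (suc m) n = begin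
    ∑ (𝔖 (suc n)) (markSum (valueᵐ (suc m)))
      ≈⟨ ∑-cong (𝔖 (suc n)) (λ {w} w∈ → markSum-cong w (growSum-value m n w∈)) ⟩
    ∑ (𝔖 (suc n)) (markSum (growSum (suc (suc n)) (valueᵐ m) []))
      ≈⟨ ∑-cong (𝔖 (suc n)) (λ {w} _ → ∑-insertions (suc (suc n)) (valueᵐ m) [] w) ⟨
    ∑ (𝔖 (suc n)) (λ w → ∑ (insertions (suc (suc n)) w) (markSum (valueᵐ m)))
      ≈⟨ ∑-concatMap (insertions (suc (suc n))) (𝔖 (suc n)) (markSum (valueᵐ m)) ⟨
    ∑ (𝔖 (suc (suc n))) (markSum (valueᵐ m))
      ≈⟨ ∑-𝔖-value m (suc n) ⟩
    ∑ (𝔖 (suc (suc n ℕ.+ m))) (λ w → weightᵐ (closed w))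
      ≡⟨ ≡.cong (λ k → ∑ (𝔖 (suc k)) (λ w → weightᵐ (closed w)))
                (ℕ.+-suc n m) ⟨
    ∑ (𝔖 (suc (n ℕ.+ suc m))) (λ w → weightᵐ (closed w)) ∎

  ∑-𝔖-weight : ∀ m → ∑ (𝔖 (suc m)) (λ w → weightᵐ (closed w)) ≈ total m
  ∑-𝔖-weight m = trans (sym (∑-𝔖-value m 0))
    (solve 5 (λ x y d f g →
      con 1 :* ((y :* con 1) :* (con 1 :* ((d :* con 1) :* con 1))) :* f :+
      (x :* con 1) :* ((y :* con 1) :* (con 1 :* (con 1 :* con 1))) :* g :+ con 0 :=
      y :* d :* f :+ x :* y :* g) refl x y d (completions m 0 0) (completions₀ m 0))

-- Statistics of words with all inner gaps closed

letters-closed : ∀ w → letters (closed w) ≡ w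
letters-closed []      = ≡.refl
letters-closed (v ∷ w) = ≡.cong (v ∷_) (letters-closed w)

dominates-closed : ∀ v w → 1 ∈ w →
  dominates v (closed w) ≡ does (all? (ℕ._>?_ v) (leftOf1 w))
dominates-closed v (u ∷ w) 1∈ with u ℕ.≟ 1
... | yes ≡.refl = ≡.refl
dominates-closed v (u ∷ w) (here ≡.refl) | no u≢1 = contradiction ≡.refl u≢1
dominates-closed v (u ∷ w) (there 1∈)    | no u≢1 rewrite ≢⇒false u≢1 =
  ≡.cong ((u <ᵇ v) ∧_) (dominates-closed v w 1∈)

rlm-closed : ∀ w → 1 ∈ w → rlmᵐ (closed w) ≡ rlm w
rlm-closed (v ∷ w) 1∈ with v ℕ.≟ 1
... | yes ≡.refl = ≡.refl
rlm-closed (v ∷ w) (here ≡.refl) | no v≢1 = contradiction ≡.refl v≢1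
rlm-closed (v ∷ w) (there 1∈)    | no v≢1 rewrite ≢⇒false v≢1 =
  ≡.cong₂ ℕ._+_ (≡.cong bit (dominates-closed v w 1∈)) (rlm-closed w 1∈)

des-closed : ∀ p w → desFrom p (closed w) ≡ des (p ∷ w)
des-closed p []      = ≡.refl
des-closed p (v ∷ w) = ≡.cong (bit (v <ᵇ p) ℕ.+_) (des-closed v w)

double-closed : ∀ p w → doubleFrom p (closed w) ≡ adj321 (p ∷ w)
double-closed p []          = ≡.refl
double-closed p (v ∷ [])    with v <ᵇ p
... | true  = ≡.refl
... | false = ≡.refl
double-closed p (v ∷ u ∷ w) =
  ≡.cong (bit ((v <ᵇ p) ∧ (u <ᵇ v)) ℕ.+_) (double-closed v (u ∷ w))

des-0∷ : ∀ w → des (0 ∷ w) ≡ des w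
des-0∷ []      = ≡.refl
des-0∷ (v ∷ w) = ≡.refl

adj321-0∷ : ∀ w → adj321 (0 ∷ w) ≡ adj321 w
adj321-0∷ []          = ≡.refl
adj321-0∷ (v ∷ [])    = ≡.refl
adj321-0∷ (v ∷ u ∷ w) = ≡.refl

-- Non-mid-point weak excedances are left-to-right maxima

countBelow : ℕ → Word → ℕ
countBelow v = count (ℕ._<? v)

-- The offset c is general because dropping the first entry of the sequence c, c + 1, ... shifts it.
countBelow-applyUpTo : ∀ c f n k → (∀ i → f i ≡ c ℕ.+ i) → k ≤ n →
                       countBelow (c ℕ.+ k) (applyUpTo f n) ≡ k
countBelow-applyUpTo c f n zero f≡ _ = ≡.cong length
  (filter-none (ℕ._<? (c ℕ.+ 0)) (All.applyUpTo⁺₂ f n λ i fi<c →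
    ℕ.<⇒≱ fi<c (≡.subst₂ _≤_ (≡.sym (ℕ.+-identityʳ c)) (≡.sym (f≡ i)) (ℕ.m≤m+n c i))))
countBelow-applyUpTo c f (suc n) (suc k) f≡ (s≤s k≤n) = ≡.trans
  (≡.cong length (filter-accept (ℕ._<? (c ℕ.+ suc k)) f0<))
  (≡.cong suc (≡.trans
    (≡.cong (λ v → countBelow v (applyUpTo (f ∘ suc) n)) (ℕ.+-suc c k))
    (countBelow-applyUpTo (suc c) (f ∘ suc) n k
      (λ i → ≡.trans (f≡ (suc i)) (ℕ.+-suc c i)) k≤n)))
  where
  f0< : f 0 < c ℕ.+ suc k
  f0< = ≡.subst (_< c ℕ.+ suc k) (≡.sym (f≡ 0)) (ℕ.+-monoʳ-< c z<s)

countBelow-𝔖 : ∀ n {w v} → w ∈ 𝔖 n → 1 ≤ v → v ≤ n → suc (countBelow v w) ≡ v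
countBelow-𝔖 n {v = suc k} w∈ _ k<n = ≡.cong suc (≡.trans
  (↭-length (filter-↭ (ℕ._<? suc k) (𝔖⇒↭ n w∈)))
  (countBelow-applyUpTo 1 suc n k (λ _ → ≡.refl) (ℕ.<⇒≤ k<n)))

≤-countBelow : ∀ v w (i : Fin (length w)) → (∀ j → j Fin.< i → lookup w j < v) →
               toℕ i ≤ countBelow v w
≤-countBelow v (u ∷ w) zero    <v = z≤n
≤-countBelow v (u ∷ w) (suc i) <v = ≡.subst (suc (toℕ i) ≤_)
  (≡.sym (≡.cong length (filter-accept (ℕ._<? v) (<v zero z<s))))
  (s≤s (≤-countBelow v w i (λ j j<i → <v (suc j) (s≤s j<i))))

countBelow-∷ : ∀ v u w → countBelow v (u ∷ w) ≤ suc (countBelow v w)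
countBelow-∷ v u w with u ℕ.<? v
... | yes u<v = ℕ.≤-reflexive (≡.cong length (filter-accept (ℕ._<? v) u<v))
... | no  u≮v = ℕ.m≤n⇒m≤1+n (ℕ.≤-reflexive (≡.cong length (filter-reject (ℕ._<? v) u≮v)))

countBelow-none : ∀ v w → (∀ k → v ≤ lookup w k) → countBelow v w ≡ 0
countBelow-none v w v≤ = ≡.cong length (filter-none (ℕ._<? v) {xs = w}
  (All.tabulate λ {u} u∈ → ℕ.≤⇒≯ (≡.subst (v ≤_) (≡.sym (lookup-index u∈)) (v≤ (index u∈)))))

countBelow-≤ : ∀ v w (i : Fin (length w)) → (∀ k → i Fin.≤ k → v ≤ lookup w k) →
               countBelow v w ≤ toℕ i
countBelow-≤ v w@(_ ∷ _) zero  v≤ = ℕ.≤-reflexive (countBelow-none v w (λ k → v≤ k z≤n))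
countBelow-≤ v (u ∷ w) (suc i) v≤ = ℕ.≤-trans (countBelow-∷ v u w)
  (s≤s (countBelow-≤ v w i (λ k i≤k → v≤ (suc k) (s≤s i≤k))))

-- Smaller letters occupy only positions before i, and position j is not one of them.
countBelow-< : ∀ v w (i j : Fin (length w)) → (∀ k → i Fin.≤ k → v ≤ lookup w k) →
               j Fin.< i → v ≤ lookup w j → countBelow v w < toℕ i
countBelow-< v (u ∷ w) (suc i) zero    v≤ _         v≤u = s≤s (ℕ.≤-trans
  (ℕ.≤-reflexive (≡.cong length (filter-reject (ℕ._<? v) (ℕ.≤⇒≯ v≤u))))
  (countBelow-≤ v w i (λ k i≤k → v≤ (suc k) (s≤s i≤k))))
countBelow-< v (u ∷ w) (suc i) (suc j) v≤ (s≤s j<i) v≤wj = ℕ.≤-<-trans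
  (countBelow-∷ v u w)
  (s≤s (countBelow-< v w i j (λ k i≤k → v≤ (suc k) (s≤s i≤k)) j<i v≤wj))

lookup-injective : ∀ {w : Word} → Unique w → ∀ i j → lookup w i ≡ lookup w j → i ≡ j
lookup-injective (_  ∷ _)  zero    zero    _  = ≡.refl
lookup-injective (u∉ ∷ _)  zero    (suc j) eq =
  contradiction eq (All.lookup u∉ (∈-lookup j))
lookup-injective (u∉ ∷ _)  (suc i) zero    eq =
  contradiction (≡.sym eq) (All.lookup u∉ (∈-lookup i))
lookup-injective (_  ∷ w!) (suc i) (suc j) eq = ≡.cong suc (lookup-injective w! i j eq)

LRMax : ℕ → (w : Word) → Pred (Fin (length w)) _
LRMax m w i = m < lookup w i × (∀ j → j Fin.< i → lookup w j < lookup w i)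

-- A weak excedance i that has a larger letter before it has a smaller one
-- after it, since fewer than i letters are smaller than π_i otherwise.
wnm⇔LRMax : ∀ n {w} → w ∈ 𝔖 n → ∀ i →
            (WeakExcedance w i × ¬ MidPoint w i) ⇔ LRMax 0 w i
wnm⇔LRMax n {w} w∈ i = mk⇔ to from
  where
  v : ℕ
  v = lookup w i

  bounds : 1 ≤ v × v ≤ n
  bounds = All.lookup (𝔖-letters n w∈) (∈-lookup i)

  v≡ : suc (countBelow v w) ≡ v
  v≡ = countBelow-𝔖 n w∈ (proj₁ bounds) (proj₂ bounds)

  to : WeakExcedance w i × ¬ MidPoint w i → LRMax 0 w i
  to (i<v , ¬mid) = proj₁ bounds , smaller
    where
    smaller : ∀ j → j Fin.< i → lookup w j < v
    smaller j j<i with lookup w j ℕ.<? v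
    ... | yes wj<v = wj<v
    ... | no  wj≮v = contradiction (ℕ.≤-trans i<v (ℕ.≤-reflexive (≡.sym v≡)))
      (ℕ.<⇒≱ (s≤s (countBelow-< v w i j after j<i v≤wj)))
      where
      v≤wj : v ≤ lookup w j
      v≤wj = ℕ.≮⇒≥ wj≮v
      v<wj : v < lookup w j
      v<wj = ℕ.≤∧≢⇒< v≤wj λ eq → ℕ.<⇒≢ j<i
        (≡.cong toℕ (lookup-injective (𝔖-distinct n w∈) j i (≡.sym eq)))
      after : ∀ k → i Fin.≤ k → v ≤ lookup w k
      after k i≤k with i Fin.≟ k
      ... | yes ≡.refl = ℕ.≤-refl
      ... | no  i≢k    = ℕ.≮⇒≥ λ wk<v → ¬mid
        (j , k , (j<i , ℕ.≤∧≢⇒< i≤k (i≢k ∘ Fin.toℕ-injective)) , v<wj , wk<v)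

  from : LRMax 0 w i → WeakExcedance w i × ¬ MidPoint w i
  from (_ , smaller) =
    -- All letters before position i are below v, while exactly v - 1 letters are below v in total.
    ℕ.≤-trans (s≤s (≤-countBelow v w i smaller)) (ℕ.≤-reflexive v≡) ,
    λ { (j , _ , (j<i , _) , (v<wj , _)) → ℕ.<-asym v<wj (smaller j j<i) }

count-map : ∀ {a b p} {A : Set a} {B : Set b} {P : Pred B p} (P? : Decidable P)
            (f : A → B) xs → count P? (map f xs) ≡ count (P? ∘ f) xs
count-map P? f []       = ≡.refl
count-map P? f (x ∷ xs) with does (P? (f x))
... | true  = ≡.cong suc (count-map P? f xs)
... | false = count-map P? f xs

count-suc : ∀ {p n} {P : Pred (Fin (suc n)) p} (P? : Decidable P) →
            count P? (tabulate suc) ≡ count (P? ∘ suc) (allFin n)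
count-suc P? = ≡.trans (≡.cong (count P?) (≡.sym (map-tabulate id suc)))
                       (count-map P? suc (allFin _))

count-LRMax : ∀ {p} m w {P : Pred (Fin (length w)) p} (P? : Decidable P) →
              (∀ i → P i ⇔ LRMax m w i) →
              count P? (allFin (length w)) ≡ lrmaxFrom m (closed w)
count-LRMax m []      P? P⇔ = ≡.refl
count-LRMax m (v ∷ w) {P} P? P⇔ with m ℕ.<? v
... | yes m<v rewrite <⇒true m<v = ≡.trans
  (≡.cong length (filter-accept P? (Equivalence.from (P⇔ zero) (m<v , λ _ ()))))
  (≡.cong suc (≡.trans (count-suc P?) (count-LRMax v w (P? ∘ suc) λ i → mk⇔
    (λ p → let m< , smaller = Equivalence.to (P⇔ (suc i)) p in
           smaller zero z<s , λ j j<i → smaller (suc j) (s≤s j<i))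
    (λ (v< , smaller) → Equivalence.from (P⇔ (suc i))
      (ℕ.<-trans m<v v< , λ { zero _ → v< ; (suc j) (s≤s j<i) → smaller j j<i })))))
... | no  m≮v rewrite ≤⇒false (ℕ.≮⇒≥ m≮v) = ≡.trans
  (≡.cong length (filter-reject P? λ p → m≮v (proj₁ (Equivalence.to (P⇔ zero) p))))
  (≡.trans (count-suc P?) (count-LRMax m w (P? ∘ suc) λ i → mk⇔
    (λ p → let m< , smaller = Equivalence.to (P⇔ (suc i)) p in
           m< , λ j j<i → smaller (suc j) (s≤s j<i))
    (λ (m< , smaller) → Equivalence.from (P⇔ (suc i))
      (m< , λ { zero _ → ℕ.≤-<-trans (ℕ.≮⇒≥ m≮v) m< ; (suc j) (s≤s j<i) → smaller j j<i }))))

wnm≡lrmax : ∀ n {w} → w ∈ 𝔖 n → wnm w ≡ lrmax w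
wnm≡lrmax n {w} w∈ = count-LRMax 0 w _ (wnm⇔LRMax n w∈)

-- Coefficient extraction

module ExponentBags (k : ℕ) where

  infixl 7 _⊗_
  infixl 6 _⊕_

  Bag : Set
  Bag = List (Vec ℕ k)

  _⊕_ : Vec ℕ k → Vec ℕ k → Vec ℕ k
  _⊕_ = Vec.zipWith ℕ._+_

  0ᵛ : Vec ℕ k
  0ᵛ = Vec.replicate k 0

  _⊗_ : Bag → Bag → Bag
  us ⊗ vs = concatMap (λ u → map (u ⊕_) vs) us

  ⊗-distribʳ-++ : ∀ ws us vs → (us ++ vs) ⊗ ws ≡ us ⊗ ws ++ vs ⊗ ws
  ⊗-distribʳ-++ ws us vs = concatMap-++ (λ u → map (u ⊕_) ws) us vs

  ⊗-∷ʳ : ∀ us v vs → us ⊗ (v ∷ vs) ↭ map (v ⊕_) us ++ us ⊗ vs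
  ⊗-∷ʳ []       v vs = ↭-refl
  ⊗-∷ʳ (u ∷ us) v vs = ↭-trans
    (↭-prep (u ⊕ v) (↭-trans (++⁺ˡ (map (u ⊕_) vs) (⊗-∷ʳ us v vs))
                              (shifts (map (u ⊕_) vs) (map (v ⊕_) us))))
    (↭-reflexive (≡.cong (_∷ map (v ⊕_) us ++ (map (u ⊕_) vs ++ us ⊗ vs))
                         (Vec.zipWith-comm ℕ.+-comm u v)))

  ⊗-zeroʳ : ∀ us → us ⊗ [] ≡ []
  ⊗-zeroʳ []       = ≡.refl
  ⊗-zeroʳ (u ∷ us) = ⊗-zeroʳ us

  ⊗-comm : ∀ us vs → us ⊗ vs ↭ vs ⊗ us
  ⊗-comm []       vs = ↭-reflexive (≡.sym (⊗-zeroʳ vs))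
  ⊗-comm (u ∷ us) vs = ↭-trans (++⁺ˡ (map (u ⊕_) vs) (⊗-comm us vs)) (↭-sym (⊗-∷ʳ vs u us))

  ⊗-congˡ : ∀ us {vs vs′} → vs ↭ vs′ → us ⊗ vs ↭ us ⊗ vs′
  ⊗-congˡ []       p = ↭-refl
  ⊗-congˡ (u ∷ us) p = ++⁺ (map⁺ (u ⊕_) p) (⊗-congˡ us p)

  ⊗-cong : ∀ {us us′ vs vs′} → us ↭ us′ → vs ↭ vs′ → us ⊗ vs ↭ us′ ⊗ vs′
  ⊗-cong {us} {us′} {vs} {vs′} p r = ↭-trans (⊗-congˡ us r)
    (↭-trans (⊗-comm us vs′) (↭-trans (⊗-congˡ vs′ p) (⊗-comm vs′ us′)))

  map-⊗ : ∀ u vs ws → map (u ⊕_) vs ⊗ ws ≡ map (u ⊕_) (vs ⊗ ws)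
  map-⊗ u []       ws = ≡.refl
  map-⊗ u (v ∷ vs) ws = ≡.trans
    (≡.cong₂ _++_
      (≡.trans (map-cong (Vec.zipWith-assoc ℕ.+-assoc u v) ws) (map-∘ ws))
      (map-⊗ u vs ws))
    (≡.sym (map-++ (u ⊕_) (map (v ⊕_) ws) (vs ⊗ ws)))

  ⊗-assoc : ∀ us vs ws → (us ⊗ vs) ⊗ ws ≡ us ⊗ (vs ⊗ ws)
  ⊗-assoc []       vs ws = ≡.refl
  ⊗-assoc (u ∷ us) vs ws = ≡.trans
    (⊗-distribʳ-++ ws (map (u ⊕_) vs) (us ⊗ vs))
    (≡.cong₂ _++_ (map-⊗ u vs ws) (⊗-assoc us vs ws))

  ⊗-identityˡ : ∀ us → [ 0ᵛ ] ⊗ us ≡ us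
  ⊗-identityˡ us = ≡.trans (++-identityʳ (map (0ᵛ ⊕_) us))
    (≡.trans (map-cong (Vec.zipWith-identityˡ ℕ.+-identityˡ) us) (map-id us))

  -- Polynomials in k variables with natural coefficients, each a bag of
  -- exponent vectors.
  bagSemiring : CommutativeSemiring 0ℓ 0ℓ
  bagSemiring = record
    { Carrier = Bag
    ; _≈_     = _↭_
    ; _+_     = _++_
    ; _*_     = _⊗_
    ; 0#      = []
    ; 1#      = [ 0ᵛ ]
    ; isCommutativeSemiring = IsCommutativeSemiringˡ.isCommutativeSemiring record
      { +-isCommutativeMonoid = ++-isCommutativeMonoid
      ; *-isCommutativeMonoid = record
        { isMonoid = record
          { isSemigroup = record
            { isMagma = record { isEquivalence = ↭-isEquivalence ; ∙-cong = ⊗-cong }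
            ; assoc   = λ us vs ws → ↭-reflexive (⊗-assoc us vs ws)
            }
          ; identity = (λ us → ↭-reflexive (⊗-identityˡ us)) ,
                       (λ us → ↭-trans (⊗-comm us [ 0ᵛ ]) (↭-reflexive (⊗-identityˡ us)))
          }
        ; comm = ⊗-comm
        }
      ; distribʳ = λ ws us vs → ↭-reflexive (⊗-distribʳ-++ ws us vs)
      ; zeroˡ    = λ _ → ↭-refl
      }
    }

-- The joint distribution as a polynomial in five variables

module StatisticsBag where
  open ExponentBags 5 using (Bag; bagSemiring)
  open import Algebra.Properties.Semiring.Exp (CommutativeSemiring.semiring bagSemiring) using (_^_)

  -- One variable for each place of the quintuple; the claim exchanges the roles of `e₂` and `e₃`.
  e₁ e₂ e₃ e₄ e₅ : Bag
  e₁ = [ 1 ∷ 0 ∷ 0 ∷ 0 ∷ 0 ∷ [] ]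
  e₂ = [ 0 ∷ 1 ∷ 0 ∷ 0 ∷ 0 ∷ [] ]
  e₃ = [ 0 ∷ 0 ∷ 1 ∷ 0 ∷ 0 ∷ [] ]
  e₄ = [ 0 ∷ 0 ∷ 0 ∷ 1 ∷ 0 ∷ [] ]
  e₅ = [ 0 ∷ 0 ∷ 0 ∷ 0 ∷ 1 ∷ [] ]

  e₁^ : ∀ n → e₁ ^ n ≡ [ n ∷ 0 ∷ 0 ∷ 0 ∷ 0 ∷ [] ]
  e₁^ zero    = ≡.refl
  e₁^ (suc n) rewrite e₁^ n = ≡.refl

  e₂^ : ∀ n → e₂ ^ n ≡ [ 0 ∷ n ∷ 0 ∷ 0 ∷ 0 ∷ [] ]
  e₂^ zero    = ≡.refl
  e₂^ (suc n) rewrite e₂^ n = ≡.refl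

  e₃^ : ∀ n → e₃ ^ n ≡ [ 0 ∷ 0 ∷ n ∷ 0 ∷ 0 ∷ [] ]
  e₃^ zero    = ≡.refl
  e₃^ (suc n) rewrite e₃^ n = ≡.refl

  e₄^ : ∀ n → e₄ ^ n ≡ [ 0 ∷ 0 ∷ 0 ∷ n ∷ 0 ∷ [] ]
  e₄^ zero    = ≡.refl
  e₄^ (suc n) rewrite e₄^ n = ≡.refl

  e₅^ : ∀ n → e₅ ^ n ≡ [ 0 ∷ 0 ∷ 0 ∷ 0 ∷ n ∷ [] ]
  e₅^ zero    = ≡.refl
  e₅^ (suc n) rewrite e₅^ n = ≡.refl

  private
    -- The first parameter marks LR-maxima and the second RL-minima, so X produces the first
    -- quintuple and Y the one with these two exchanged.
    module X = HistorySums bagSemiring e₃ e₂ e₁ e₄ e₅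
    module Y = HistorySums bagSemiring e₂ e₃ e₁ e₄ e₅

  monomial-lrmax-rlmin : ∀ a b c e f → X.monomial a b c e f ≡ [ c ∷ b ∷ a ∷ e ∷ f ∷ [] ]
  monomial-lrmax-rlmin a b c e f
    rewrite e₃^ a | e₂^ b | e₁^ c | e₄^ e | e₅^ f
    | ℕ.+-identityʳ a | ℕ.+-identityʳ b | ℕ.+-identityʳ c | ℕ.+-identityʳ e = ≡.refl

  monomial-rlmin-lrmax : ∀ a b c e f → Y.monomial a b c e f ≡ [ c ∷ a ∷ b ∷ e ∷ f ∷ [] ]
  monomial-rlmin-lrmax a b c e f
    rewrite e₂^ a | e₃^ b | e₁^ c | e₄^ e | e₅^ f
    | ℕ.+-identityʳ a | ℕ.+-identityʳ b | ℕ.+-identityʳ c | ℕ.+-identityʳ e = ≡.refl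

  open Sums bagSemiring using (∑; ∑-cong)

  ∑-[] : ∀ {a} {A : Set a} (f : A → Vec ℕ 5) xs → ∑ xs (λ x → [ f x ]) ≡ map f xs
  ∑-[] f []       = ≡.refl
  ∑-[] f (x ∷ xs) = ≡.cong (f x ∷_) (∑-[] f xs)

  statistics statistics′ : Vec (Word → ℕ) 5
  statistics  = rlm ∷ rlmin ∷ wnm ∷ des ∷ adj321 ∷ []
  statistics′ = rlm ∷ wnm ∷ rlmin ∷ des ∷ adj321 ∷ []

  weight-statistics : ∀ n {w} → w ∈ 𝔖 (suc n) →
    X.weightᵐ (closed w) ≡ [ values statistics w ]
  weight-statistics n {w} w∈
    rewrite monomial-lrmax-rlmin (lrmax w) (rlmin (letters (closed w)))
      (rlmᵐ (closed w)) (desFrom 0 (closed w)) (doubleFrom 0 (closed w))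
    | letters-closed w | rlm-closed w (𝔖-∋1 n w∈) | des-closed 0 w | des-0∷ w
    | double-closed 0 w | adj321-0∷ w | wnm≡lrmax (suc n) w∈ = ≡.refl

  weight-statistics′ : ∀ n {w} → w ∈ 𝔖 (suc n) →
    Y.weightᵐ (closed w) ≡ [ values statistics′ w ]
  weight-statistics′ n {w} w∈
    rewrite monomial-rlmin-lrmax (lrmax w) (rlmin (letters (closed w)))
      (rlmᵐ (closed w)) (desFrom 0 (closed w)) (doubleFrom 0 (closed w))
    | letters-closed w | rlm-closed w (𝔖-∋1 n w∈) | des-closed 0 w | des-0∷ w
    | double-closed 0 w | adj321-0∷ w | wnm≡lrmax (suc n) w∈ = ≡.refl

  -- Equality in the semiring of bags is rearrangement of exponent vectors, so the symmetry of
  -- `total` is itself the equidistribution.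
  statistics-↭ : ∀ n → map (values statistics) (𝔖 (suc n)) ↭ map (values statistics′) (𝔖 (suc n))
  statistics-↭ n = begin
    map (values statistics) (𝔖 (suc n))
      ≡⟨ ∑-[] (values statistics) (𝔖 (suc n)) ⟨
    ∑ (𝔖 (suc n)) (λ w → [ values statistics w ])
      ↭⟨ ∑-cong (𝔖 (suc n)) (λ w∈ → ↭-reflexive (weight-statistics n w∈)) ⟨
    ∑ (𝔖 (suc n)) (λ w → X.weightᵐ (closed w))
      ↭⟨ Transfer.∑-𝔖-weight bagSemiring e₃ e₂ e₁ e₄ e₅ n ⟩
    Weighted.total e₃ e₂ e₁ e₄ e₅ n
      ↭⟨ total-sym e₃ e₂ e₁ e₄ e₅ n ⟩
    Weighted.total e₂ e₃ e₁ e₄ e₅ n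
      ↭⟨ Transfer.∑-𝔖-weight bagSemiring e₂ e₃ e₁ e₄ e₅ n ⟨
    ∑ (𝔖 (suc n)) (λ w → Y.weightᵐ (closed w))
      ↭⟨ ∑-cong (𝔖 (suc n)) (λ w∈ → ↭-reflexive (weight-statistics′ n w∈)) ⟩
    ∑ (𝔖 (suc n)) (λ w → [ values statistics′ w ])
      ≡⟨ ∑-[] (values statistics′) (𝔖 (suc n)) ⟩
    map (values statistics′) (𝔖 (suc n)) ∎
    where
    open PermutationReasoning
    open HistoryAlgebra bagSemiring

equidistributed-↭ : ∀ {a} {A : Set a} {k} (xs : List A) (fs gs : Vec (A → ℕ) k) →
  map (values fs) xs ↭ map (values gs) xs → EquallyDistributedOn xs fs gs
equidistributed-↭ xs fs gs p as = ≡.trans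
  (≡.sym (count-map (λ vs → Vec.≡-dec ℕ._≟_ vs as) (values fs) xs))
  (≡.trans (↭-length (filter-↭ (λ vs → Vec.≡-dec ℕ._≟_ vs as) p))
           (count-map (λ vs → Vec.≡-dec ℕ._≟_ vs as) (values gs) xs))

-- The rising factorial

-- Fixing the letters above n + 1 makes this an involution on all of ℕ.
complement : ℕ → ℕ → ℕ
complement n v with v ℕ.≤? suc n
... | yes _ = suc n ∸ v
... | no  _ = v

complement-≤ : ∀ {n v} → v ≤ suc n → complement n v ≡ suc n ∸ v
complement-≤ {n} {v} v≤ with v ℕ.≤? suc n
... | yes _  = ≡.refl
... | no  v≰ = contradiction v≤ v≰

complement-involutive : ∀ n v → complement n (complement n v) ≡ v
complement-involutive n v with v ℕ.≤? suc n
... | yes v≤ = ≡.trans (complement-≤ (ℕ.m∸n≤m (suc n) v)) (ℕ.m∸[m∸n]≡n v≤)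
... | no  v≰ with v ℕ.≤? suc n
...   | yes v≤ = contradiction v≤ v≰
...   | no  _  = ≡.refl

complementʷ : ℕ → Word → Word
complementʷ n = map (complement n)

complementʷ-involutive : ∀ n w → complementʷ n (complementʷ n w) ≡ w
complementʷ-involutive n w =
  ≡.trans (≡.sym (map-∘ w)) (≡.trans (map-cong (complement-involutive n) w) (map-id w))

complementʷ-𝔖 : ∀ n {w} → w ∈ 𝔖 n → complementʷ n w ∈ 𝔖 n
complementʷ-𝔖 n {w} w∈ = Equivalence.from (𝔖-complete n) (begin
  complementʷ n w               ↭⟨ map⁺ (complement n) (𝔖⇒↭ n w∈) ⟩
  complementʷ n [1⋯ n ]         ≡⟨ map-applyUpTo suc (complement n) n ⟩
  applyUpTo (complement n ∘ suc) n ≡⟨ applyUpTo-cong n (λ i<n → complement-≤ (ℕ.m≤n⇒m≤1+n i<n)) ⟩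
  applyUpTo (n ∸_) n            ≡⟨ applyUpTo-∸ n ⟩
  applyDownFrom suc n           ≡⟨ reverse-applyUpTo suc n ⟨
  reverse [1⋯ n ] ↭⟨ ↭-reverse [1⋯ n ] ⟩
  [1⋯ n ]                       ∎)
  where
  open PermutationReasoning
  applyUpTo-cong : ∀ {f g : ℕ → ℕ} n → (∀ {i} → i < n → f i ≡ g i) →
                   applyUpTo f n ≡ applyUpTo g n
  applyUpTo-cong zero    f≡g = ≡.refl
  applyUpTo-cong (suc n) f≡g = ≡.cong₂ _∷_ (f≡g z<s) (applyUpTo-cong n (λ i<n → f≡g (s≤s i<n)))
  applyUpTo-∸ : ∀ n → applyUpTo (n ∸_) n ≡ applyDownFrom suc n
  applyUpTo-∸ zero    = ≡.refl
  applyUpTo-∸ (suc n) = ≡.cong (suc n ∷_) (applyUpTo-∸ n)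

-- Both lists are free of repetitions, and the involution permutes their common members.
map-complementʷ-𝔖 : ∀ n → map (complementʷ n) (𝔖 n) ↭ 𝔖 n
map-complementʷ-𝔖 n = ∼bag⇒↭ (unique∧set⇒bag
  (Unique.map⁺ injective (𝔖-unique n)) (𝔖-unique n) (mk⇔ to from))
  where
  injective : ∀ {v w} → complementʷ n v ≡ complementʷ n w → v ≡ w
  injective {v} {w} eq = ≡.trans (≡.sym (complementʷ-involutive n v))
    (≡.trans (≡.cong (complementʷ n) eq) (complementʷ-involutive n w))
  to : ∀ {w} → w ∈ map (complementʷ n) (𝔖 n) → w ∈ 𝔖 n
  to w∈ with v , v∈ , ≡.refl ← ∈-map⁻ (complementʷ n) w∈ = complementʷ-𝔖 n v∈
  from : ∀ {w} → w ∈ 𝔖 n → w ∈ map (complementʷ n) (𝔖 n)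
  from {w} w∈ = ≡.subst (_∈ map (complementʷ n) (𝔖 n)) (complementʷ-involutive n w)
    (∈-map⁺ (complementʷ n) (complementʷ-𝔖 n w∈))

-- Left-to-right minima under insertion and complement

lrminFrom : ℕ → Word → ℕ
lrminFrom m []      = 0
lrminFrom m (v ∷ w) = if v <ᵇ m then suc (lrminFrom v w) else lrminFrom m w

lrmin : Word → ℕ
lrmin []      = 0
lrmin (v ∷ w) = suc (lrminFrom v w)

lrminFrom-above : ∀ N w → All (_< N) w → lrminFrom N w ≡ lrmin w
lrminFrom-above N []      []          = ≡.refl
lrminFrom-above N (v ∷ w) (v<N ∷ w<N) rewrite <⇒true v<N = ≡.refl

-- The running minimum never exceeds m, so N is no record and leaves it unchanged.
lrminFrom-insert : ∀ {N m} us vs → m < N → lrminFrom m (us ++ N ∷ vs) ≡ lrminFrom m (us ++ vs)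
lrminFrom-insert []       vs m<N rewrite ≤⇒false (ℕ.<⇒≤ m<N) = ≡.refl
lrminFrom-insert {N} {m} (u ∷ us) vs m<N with u ℕ.<? m
... | yes u<m rewrite <⇒true u<m =
  ≡.cong suc (lrminFrom-insert us vs (ℕ.<-trans u<m m<N))
... | no  u≮m rewrite ≤⇒false (ℕ.≮⇒≥ u≮m) = lrminFrom-insert us vs m<N

all?-insert : ∀ {N m} us vs → m < N →
  does (all? (m ℕ.<?_) (us ++ N ∷ vs)) ≡ does (all? (m ℕ.<?_) (us ++ vs))
all?-insert []       vs m<N rewrite <⇒true m<N = ≡.refl
all?-insert {m = m} (u ∷ us) vs m<N = ≡.cong ((m <ᵇ u) ∧_) (all?-insert us vs m<N)

∈-insertions⁻ : ∀ {N w} v → w ∈ insertions N v →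
                ∃₂ λ us vs → v ≡ us ++ vs × w ≡ us ++ N ∷ vs
∈-insertions⁻ []      (here ≡.refl) = [] , [] , ≡.refl , ≡.refl
∈-insertions⁻ (y ∷ v) (here ≡.refl) = [] , y ∷ v , ≡.refl , ≡.refl
∈-insertions⁻ (y ∷ v) (there w∈) with ∈-map⁻ (y ∷_) w∈
... | u , u∈ , ≡.refl with ∈-insertions⁻ v u∈
... | us , vs , ≡.refl , ≡.refl = y ∷ us , vs , ≡.refl , ≡.refl

-- A split is a place for the letter that complementing turns into 1.
splits : Word → List (Word × Word)
splits []      = ([] , []) ∷ []
splits (v ∷ w) = ([] , v ∷ w) ∷ map (λ (us , vs) → v ∷ us , vs) (splits w)

∈-splits⁻ : ∀ {us vs} w → (us , vs) ∈ splits w → us ++ vs ≡ w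
∈-splits⁻ []      (here ≡.refl) = ≡.refl
∈-splits⁻ (v ∷ w) (here ≡.refl) = ≡.refl
∈-splits⁻ (v ∷ w) (there p) with ∈-map⁻ _ p
... | _ , q , ≡.refl = ≡.cong (v ∷_) (∈-splits⁻ w q)

-- The exponents below are those of lrmax ∸ 1 and rlm for the complement of
-- us ++ N ∷ vs, where N exceeds all letters of us and vs.
lrminSplit : Word → Word → ℕ
lrminSplit []       vs = lrmin vs
lrminSplit (u ∷ us) vs = lrminFrom u (us ++ vs)

module _ (m : ℕ) where
  private
    c : ℕ → ℕ
    c = complement (suc m)

  complement-< : ∀ {u v} → u ≤ suc m → v ≤ suc m → (c u <ᵇ c v) ≡ (v <ᵇ u)
  complement-< {u} {v} u≤ v≤
    rewrite complement-≤ (ℕ.m≤n⇒m≤1+n u≤) | complement-≤ (ℕ.m≤n⇒m≤1+n v≤)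
    with v ℕ.<? u
  ... | yes v<u rewrite <⇒true v<u = <⇒true (ℕ.∸-monoʳ-< v<u (ℕ.m≤n⇒m≤1+n u≤))
  ... | no  v≮u rewrite ≤⇒false (ℕ.≮⇒≥ v≮u) = ≤⇒false (ℕ.∸-monoʳ-≤ (suc (suc m)) (ℕ.≮⇒≥ v≮u))

  lrmaxFrom-complement : ∀ {a} w → a ≤ suc m → All (_≤ suc m) w →
    lrmaxFrom (c a) (closed (map c w)) ≡ lrminFrom a w
  lrmaxFrom-complement []      a≤ []        = ≡.refl
  lrmaxFrom-complement {a} (v ∷ w) a≤ (v≤ ∷ w≤)
    rewrite complement-< a≤ v≤ | lrmaxFrom-complement w v≤ w≤
          | lrmaxFrom-complement w a≤ w≤ = ≡.refl

  complement-max : c (suc m) ≡ 1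
  complement-max = ≡.trans (complement-≤ (ℕ.n≤1+n (suc m))) (ℕ.m+n∸n≡m 1 (suc m))

  complement-positive : ∀ {v} → v ≤ suc m → 0 < c v
  complement-positive v≤ rewrite complement-≤ (ℕ.m≤n⇒m≤1+n v≤) = ℕ.m<n⇒0<n∸m (s≤s v≤)

  -- Complementing turns minima into maxima. The `suc` is the leading letter; the largest letter is
  -- a left-to-right minimum only if it leads.
  lrmax-complement : ∀ us vs → All (_< suc m) (us ++ vs) →
    lrmax (complementʷ (suc m) (us ++ suc m ∷ vs)) ≡ suc (lrminSplit us vs)
  lrmax-complement [] vs vs<
    rewrite <⇒true (complement-positive {suc m} ℕ.≤-refl)
    | lrmaxFrom-complement {suc m} vs ℕ.≤-refl (All.map ℕ.<⇒≤ vs<)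
    | lrminFrom-above (suc m) vs vs< = ≡.refl
  lrmax-complement (u ∷ us) vs (u< ∷ w<)
    rewrite <⇒true (complement-positive {u} (ℕ.<⇒≤ u<))
    | lrmaxFrom-complement {u} (us ++ suc m ∷ vs) (ℕ.<⇒≤ u<)
        (All.++⁺ (All.map ℕ.<⇒≤ (All.++⁻ˡ us w<))
                 (ℕ.≤-refl ∷ All.map ℕ.<⇒≤ (All.++⁻ʳ us w<)))
    | lrminFrom-insert us vs u< = ≡.refl

  complement-≢1 : ∀ {v} → v < suc m → c v ≢ 1
  complement-≢1 {v} v<
    rewrite complement-≤ (ℕ.<⇒≤ (ℕ.m<n⇒m<1+n v<)) | ℕ.+-∸-assoc 1 (ℕ.<⇒≤ v<) = λ eq →
      ℕ.<⇒≢ (ℕ.m<n⇒0<n∸m v<) (≡.sym (ℕ.suc-injective eq))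

  leftOf1-complement : ∀ us vs → All (_< suc m) us →
    leftOf1 (complementʷ (suc m) (us ++ suc m ∷ vs)) ≡ map c us
  leftOf1-complement []       vs []          rewrite complement-max = ≡.refl
  leftOf1-complement (u ∷ us) vs (u< ∷ us<)
    rewrite ≢⇒false (complement-≢1 u<) = ≡.cong (c u ∷_) (leftOf1-complement us vs us<)

  rlmax-complement : ∀ us → All (_≤ suc m) us → rlmax (map c us) ≡ rlmin us
  rlmax-complement []       []          = ≡.refl
  rlmax-complement (u ∷ us) (u≤ ∷ us≤) =
    ≡.cong₂ (λ b n → bit b ℕ.+ n) (all us us≤) (rlmax-complement us us≤)
    where
    all : ∀ vs → All (_≤ suc m) vs →
          does (all? (c u ℕ.>?_) (map c vs)) ≡ does (all? (u ℕ.<?_) vs)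
    all []       []         = ≡.refl
    all (v ∷ vs) (v≤ ∷ vs≤) = ≡.cong₂ _∧_ (complement-< v≤ u≤) (all vs vs≤)

  -- The largest letter becomes 1, with the complement of `us` to its left, and RL-minima become
  -- RL-maxima.
  rlm-complement : ∀ us vs → All (_< suc m) us →
    rlm (complementʷ (suc m) (us ++ suc m ∷ vs)) ≡ rlmin us
  rlm-complement us vs us< = ≡.trans (≡.cong rlmax (leftOf1-complement us vs us<))
    (rlmax-complement us (All.map ℕ.<⇒≤ us<))

-- Evaluation of the generating function as a rising factorial

module RisingFactorial {c ℓ} (R : CommutativeRing c ℓ) (x q : CommutativeRing.Carrier R) where
  private
    module S = CommutativeSemiring (CommutativeRing.commutativeSemiring R)
  open S hiding (zero; refl; sym; trans)
  open Polynomial R using (_^_; rising)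
  open import Algebra.Properties.Semiring.Exp semiring using (^-homo-*)
  open import Algebra.Properties.Semiring.Mult semiring using (×-homo-+)
    renaming (_×_ to _·_)
  open import Algebra.Solver.Ring.NaturalCoefficients.Default
    (CommutativeRing.commutativeSemiring R)
    using (solve; _:+_; _:*_; _:=_; con)
  open import Relation.Binary.Reasoning.Setoid setoid
  open Sums (CommutativeRing.commutativeSemiring R)

  ∑-↭ : ∀ {a} {A : Set a} {us vs : List A} (f : A → Carrier) → us ↭ vs → ∑ us f ≈ ∑ vs f
  ∑-↭ f _↭_.refl         = S.refl
  ∑-↭ f (_↭_.prep u p)   = +-congˡ (∑-↭ f p)
  ∑-↭ f (_↭_.swap u v p) = S.trans
    (+-congˡ (+-congˡ (∑-↭ f p)))
    (solve 3 (λ a b s → a :+ (b :+ s) := b :+ (a :+ s)) (S.refl) (f u) (f v) _)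
  ∑-↭ f (_↭_.trans p r)  = S.trans (∑-↭ f p) (∑-↭ f r)

  ∑-insertions-splits : ∀ N w (f : Word → Carrier) →
    ∑ (insertions N w) f ≈ ∑ (splits w) (λ (us , vs) → f (us ++ N ∷ vs))
  ∑-insertions-splits N []      f = S.refl
  ∑-insertions-splits N (v ∷ w) f = +-congˡ (begin
    ∑ (map (v ∷_) (insertions N w)) f
      ≡⟨ ∑-map (v ∷_) (insertions N w) f ⟩
    ∑ (insertions N w) (f ∘ (v ∷_))
      ≈⟨ ∑-insertions-splits N w (f ∘ (v ∷_)) ⟩
    ∑ (splits w) (λ (us , vs) → f (v ∷ us ++ N ∷ vs))
      ≡⟨ ∑-map (λ (us , vs) → v ∷ us , vs) (splits w) (λ (us , vs) → f (us ++ N ∷ vs)) ⟨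
    ∑ (map (λ (us , vs) → v ∷ us , vs) (splits w)) (λ (us , vs) → f (us ++ N ∷ vs)) ∎)

  -- Choosing the split first, N falls on one of its two sides; the split point itself is available
  -- on both, which matches the splits just before and just after N.
  ∑-splits-insertions : ∀ N w (f : Word → Word → Carrier) →
    ∑ (insertions N w) (λ w′ → ∑ (splits w′) (λ (us , vs) → f us vs)) ≈
    ∑ (splits w) (λ (us , vs) → ∑ (insertions N us) (λ us′ → f us′ vs) +
                                ∑ (insertions N vs) (λ vs′ → f us vs′))
  ∑-splits-insertions N []      f =
    solve 2 (λ a b → a :+ (b :+ con 0) :+ con 0 := b :+ con 0 :+ (a :+ con 0) :+ con 0)
      S.refl (f [] (N ∷ [])) (f (N ∷ []) [])
  ∑-splits-insertions N (v ∷ w) f = begin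
    f [] (N ∷ v ∷ w) + (f (N ∷ []) (v ∷ w) +
      ∑ (map (cons N) (map (cons v) (splits w))) (λ (us , vs) → f us vs)) +
    ∑ (map (v ∷_) (insertions N w)) (λ w′ → ∑ (splits w′) (λ (us , vs) → f us vs))
      ≡⟨ ≡.cong₂ (λ s s′ → f [] (N ∷ v ∷ w) + (f (N ∷ []) (v ∷ w) + s) + s′)
           (≡.trans (∑-map (cons N) (map (cons v) (splits w)) _) (∑-map (cons v) (splits w) _))
           (∑-map (v ∷_) (insertions N w) _) ⟩
    f [] (N ∷ v ∷ w) + (f (N ∷ []) (v ∷ w) + F) +
    ∑ (insertions N w) (λ w′ → f [] (v ∷ w′) +
                               ∑ (map (cons v) (splits w′)) (λ (us , vs) → f us vs))
      ≈⟨ +-congˡ (S.trans (∑-+ (insertions N w) _ _) (+-congˡ (S.trans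
           (∑-cong (insertions N w) (λ {w′} _ → reflexive (∑-map (cons v) (splits w′) _)))
           (∑-splits-insertions N w (λ us vs → f (v ∷ us) vs))))) ⟩
    f [] (N ∷ v ∷ w) + (f (N ∷ []) (v ∷ w) + F) + (G + H)
      ≈⟨ solve 5 (λ a b f g h → a :+ (b :+ f) :+ (g :+ h) :=
                                b :+ con 0 :+ (a :+ g) :+ (f :+ h)) S.refl _ _ _ _ _ ⟩
    f (N ∷ []) (v ∷ w) + 0# + (f [] (N ∷ v ∷ w) + G) + (F + H)
      ≈⟨ +-cong
           (+-congˡ (+-congˡ (reflexive (≡.sym (∑-map (v ∷_) (insertions N w) (f []))))))
           (S.trans (S.sym (∑-+ (splits w) _ _))
             (S.trans
               (∑-cong (splits w) (λ {(us , vs)} _ → S.trans (S.sym (+-assoc _ _ _))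
                 (+-congʳ (+-congˡ (reflexive
                   (≡.sym (∑-map (v ∷_) (insertions N us) (λ us′ → f us′ vs))))))))
               (reflexive (≡.sym (∑-map (cons v) (splits w) _))))) ⟩
    ∑ (splits (v ∷ w)) (λ (us , vs) → ∑ (insertions N us) (λ us′ → f us′ vs) +
                                      ∑ (insertions N vs) (λ vs′ → f us vs′)) ∎
    where
    cons : ℕ → Word × Word → Word × Word
    cons u (us , vs) = u ∷ us , vs
    F G H : Carrier
    F = ∑ (splits w) (λ (us , vs) → f (N ∷ v ∷ us) vs)
    G = ∑ (insertions N w) (λ w′ → f [] (v ∷ w′))
    H = ∑ (splits w) (λ (us , vs) → ∑ (insertions N us) (λ us′ → f (v ∷ us′) vs) +
                                    ∑ (insertions N vs) (λ vs′ → f (v ∷ us) vs′))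

  ι : ℕ → Carrier
  ι n = n · 1#

  term : Word → Word → Carrier
  term us vs = x ^ lrminSplit us vs * q ^ rlmin us

  ∑-const : ∀ N w (f : Word → Carrier) s → (∀ {w′} → w′ ∈ insertions N w → f w′ ≈ s) →
            ∑ (insertions N w) f ≈ ι (suc (length w)) * s
  ∑-const N []      f s f≈s =
    S.trans (+-congʳ (f≈s (here ≡.refl)))
            (solve 1 (λ s → s :+ con 0 := (con 1 :+ con 0) :* s) S.refl s)
  ∑-const N (v ∷ w) f s f≈s = S.trans
    (+-cong (f≈s (here ≡.refl))
      (S.trans (reflexive (∑-map (v ∷_) (insertions N w) f))
        (∑-const N w (f ∘ (v ∷_)) s (λ w′∈ → f≈s (there (∈-map⁺ (v ∷_) w′∈))))))
    (solve 2 (λ k s → s :+ k :* s := (con 1 :+ k) :* s) S.refl (ι (suc (length w))) s)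

  rlmin-insertion : ∀ {N u w} v → u < N → w ∈ insertions N v →
    q ^ rlmin (u ∷ w) ≈ q ^ bit (does (all? (u ℕ.<?_) v)) * q ^ rlmin w
  rlmin-insertion {u = u} {w} v u<N w∈ with ∈-insertions⁻ v w∈
  ... | us , vs , ≡.refl , ≡.refl rewrite all?-insert us vs u<N =
    ^-homo-* q (bit (does (all? (u ℕ.<?_) (us ++ vs)))) (rlmin w)

  -- A largest letter is an RL-minimum only in the last place.
  ∑-rlmin : ∀ {N} w → All (_< N) w →
    ∑ (insertions N w) (λ w′ → q ^ rlmin w′) ≈ (q + ι (length w)) * q ^ rlmin w
  ∑-rlmin []      []          =
    solve 1 (λ q → q :* con 1 :+ con 0 := (q :+ con 0) :* con 1) S.refl q
  ∑-rlmin {N} (u ∷ w) (u<N ∷ w<N) = begin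
    q ^ rlmin (N ∷ u ∷ w) + ∑ (map (u ∷_) (insertions N w)) (λ w′ → q ^ rlmin w′)
      ≈⟨ +-cong (reflexive (≡.cong (q ^_) rlmin-N∷)) (S.trans
           (reflexive (∑-map (u ∷_) (insertions N w) (λ w′ → q ^ rlmin w′)))
           (S.trans (∑-cong (insertions N w) (rlmin-insertion w u<N))
             (S.trans (∑-*ˡ (insertions N w) _ _) (*-congˡ (∑-rlmin w w<N))))) ⟩
    q ^ rlmin (u ∷ w) + q ^ bit b * ((q + ι (length w)) * q ^ rlmin w)
      ≈⟨ +-congˡ (solve 3 (λ a k e → a :* (k :* e) := k :* (a :* e)) S.refl
           (q ^ bit b) (q + ι (length w)) (q ^ rlmin w)) ⟩
    q ^ rlmin (u ∷ w) + (q + ι (length w)) * (q ^ bit b * q ^ rlmin w)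
      ≈⟨ +-congˡ (*-congˡ (^-homo-* q (bit b) (rlmin w))) ⟨
    q ^ rlmin (u ∷ w) + (q + ι (length w)) * q ^ rlmin (u ∷ w)
      ≈⟨ solve 3 (λ q k e → e :+ (q :+ k) :* e := (q :+ (con 1 :+ k)) :* e) S.refl
           q (ι (length w)) (q ^ rlmin (u ∷ w)) ⟩
    (q + ι (suc (length w))) * q ^ rlmin (u ∷ w) ∎
    where
    b : Bool
    b = does (all? (u ℕ.<?_) w)
    rlmin-N∷ : rlmin (N ∷ u ∷ w) ≡ rlmin (u ∷ w)
    rlmin-N∷ rewrite ≤⇒false (ℕ.<⇒≤ u<N) = ≡.refl

  -- A largest letter is a left-to-right minimum only in the first place.
  ∑-lrmin : ∀ {N} w → All (_< N) w →
    ∑ (insertions N w) (λ w′ → x ^ lrmin w′) ≈ (x + ι (length w)) * x ^ lrmin w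
  ∑-lrmin []      []          =
    solve 1 (λ x → x :* con 1 :+ con 0 := (x :+ con 0) :* con 1) S.refl x
  ∑-lrmin {N} (u ∷ w) (u<N ∷ w<N) = begin
    x ^ lrmin (N ∷ u ∷ w) + ∑ (map (u ∷_) (insertions N w)) (λ w′ → x ^ lrmin w′)
      ≈⟨ +-cong (reflexive (≡.cong (x ^_) lrmin-N∷)) (S.trans
           (reflexive (∑-map (u ∷_) (insertions N w) (λ w′ → x ^ lrmin w′)))
           (∑-const N w _ (x ^ lrmin (u ∷ w)) lrmin-u∷)) ⟩
    x * x ^ lrmin (u ∷ w) + ι (suc (length w)) * x ^ lrmin (u ∷ w)
      ≈⟨ distribʳ _ _ _ ⟨
    (x + ι (suc (length w))) * x ^ lrmin (u ∷ w) ∎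
    where
    lrmin-N∷ : lrmin (N ∷ u ∷ w) ≡ suc (lrmin (u ∷ w))
    lrmin-N∷ rewrite <⇒true u<N = ≡.refl
    lrmin-u∷ : ∀ {w′} → w′ ∈ insertions N w → x ^ lrmin (u ∷ w′) ≈ x ^ lrmin (u ∷ w)
    lrmin-u∷ w′∈ with ∈-insertions⁻ w w′∈
    ... | us , vs , ≡.refl , ≡.refl =
      reflexive (≡.cong (λ n → x ^ suc n) (lrminFrom-insert us vs u<N))

  -- The very first place gives x and the last place before the split gives q; all others give 1. If
  -- `us` is empty, these are the first place of `vs` and the only place in `us`.
  ∑-term : ∀ {N} us vs → All (_< N) us → All (_< N) vs →
    ∑ (insertions N us) (λ us′ → term us′ vs) + ∑ (insertions N vs) (λ vs′ → term us vs′) ≈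
    (x + q + ι (length (us ++ vs))) * term us vs
  ∑-term {N} [] vs [] vs<N = begin
    x ^ lrminFrom N vs * (q * 1#) + 0# + ∑ (insertions N vs) (λ vs′ → x ^ lrmin vs′ * 1#)
      ≈⟨ +-cong (+-congʳ (*-congʳ (reflexive (≡.cong (x ^_) (lrminFrom-above N vs vs<N)))))
           (S.trans (∑-cong (insertions N vs) (λ _ → *-identityʳ _)) (∑-lrmin vs vs<N)) ⟩
    x ^ lrmin vs * (q * 1#) + 0# + (x + ι (length vs)) * x ^ lrmin vs
      ≈⟨ solve 4 (λ x q k e → e :* (q :* con 1) :+ con 0 :+ (x :+ k) :* e :=
                              (x :+ q :+ k) :* (e :* con 1)) S.refl x q (ι (length vs)) _ ⟩
    (x + q + ι (length vs)) * term [] vs ∎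
  ∑-term {N} (u ∷ us) vs (u<N ∷ us<N) vs<N = begin
    term (N ∷ u ∷ us) vs + ∑ (map (u ∷_) (insertions N us)) (λ us′ → term us′ vs) +
    ∑ (insertions N vs) (term (u ∷ us))
      ≈⟨ +-cong (+-cong (reflexive front) inner)
           (∑-const N vs (term (u ∷ us)) (term (u ∷ us) vs) right) ⟩
    x * x ^ lrminFrom u (us ++ vs) * q ^ rlmin (u ∷ us) +
    x ^ lrminFrom u (us ++ vs) * ((q + ι (length us)) * q ^ rlmin (u ∷ us)) +
    ι (suc (length vs)) * term (u ∷ us) vs
      ≈⟨ solve 6 (λ x q k l e g →
           x :* e :* g :+ e :* ((q :+ k) :* g) :+ (con 1 :+ l) :* (e :* g) :=
           (x :+ q :+ (con 1 :+ (k :+ l))) :* (e :* g)) S.refl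
           x q (ι (length us)) (ι (length vs)) _ _ ⟩
    (x + q + (1# + (ι (length us) + ι (length vs)))) * term (u ∷ us) vs
      ≈⟨ *-congʳ (+-congˡ (+-congˡ (S.trans (S.sym (×-homo-+ 1# (length us) (length vs)))
           (reflexive (≡.cong ι (≡.sym (length-++ us))))))) ⟩
    (x + q + ι (length (u ∷ us ++ vs))) * term (u ∷ us) vs ∎
    where
    b : Bool
    b = does (all? (u ℕ.<?_) us)
    front : term (N ∷ u ∷ us) vs ≡ x * x ^ lrminFrom u (us ++ vs) * q ^ rlmin (u ∷ us)
    front rewrite <⇒true u<N | ≤⇒false (ℕ.<⇒≤ u<N) = ≡.refl
    lrminFrom-u : ∀ {us′} → us′ ∈ insertions N us →
                  lrminFrom u (us′ ++ vs) ≡ lrminFrom u (us ++ vs)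
    lrminFrom-u us′∈ with ∈-insertions⁻ us us′∈
    ... | as , bs , ≡.refl , ≡.refl
      rewrite ++-assoc as (N ∷ bs) vs
            | ++-assoc as bs vs = lrminFrom-insert as (bs ++ vs) u<N
    inner : ∑ (map (u ∷_) (insertions N us)) (λ us′ → term us′ vs) ≈
            x ^ lrminFrom u (us ++ vs) * ((q + ι (length us)) * q ^ rlmin (u ∷ us))
    inner = begin
      ∑ (map (u ∷_) (insertions N us)) (λ us′ → term us′ vs)
        ≡⟨ ∑-map (u ∷_) (insertions N us) (λ us′ → term us′ vs) ⟩
      ∑ (insertions N us) (λ us′ → x ^ lrminFrom u (us′ ++ vs) * q ^ rlmin (u ∷ us′))
        ≈⟨ ∑-cong (insertions N us) (λ us′∈ → S.trans
             (*-cong (reflexive (≡.cong (x ^_) (lrminFrom-u us′∈))) (rlmin-insertion us u<N us′∈))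
             (S.sym (*-assoc _ _ _))) ⟩
      ∑ (insertions N us) (λ us′ → x ^ lrminFrom u (us ++ vs) * q ^ bit b * q ^ rlmin us′)
        ≈⟨ ∑-*ˡ (insertions N us) _ _ ⟩
      x ^ lrminFrom u (us ++ vs) * q ^ bit b * ∑ (insertions N us) (λ us′ → q ^ rlmin us′)
        ≈⟨ *-congˡ (∑-rlmin us us<N) ⟩
      x ^ lrminFrom u (us ++ vs) * q ^ bit b * ((q + ι (length us)) * q ^ rlmin us)
        ≈⟨ solve 4 (λ e a k g → e :* a :* (k :* g) := e :* (k :* (a :* g))) S.refl _ _ _ _ ⟩
      x ^ lrminFrom u (us ++ vs) * ((q + ι (length us)) * (q ^ bit b * q ^ rlmin us))
        ≈⟨ *-congˡ (*-congˡ (^-homo-* q (bit b) (rlmin us))) ⟨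
      x ^ lrminFrom u (us ++ vs) * ((q + ι (length us)) * q ^ rlmin (u ∷ us)) ∎
    right : ∀ {vs′} → vs′ ∈ insertions N vs → term (u ∷ us) vs′ ≈ term (u ∷ us) vs
    right vs′∈ with ∈-insertions⁻ vs vs′∈
    ... | as , bs , ≡.refl , ≡.refl
      rewrite ≡.sym (++-assoc us as (N ∷ bs))
            | ≡.sym (++-assoc us as bs)
            | lrminFrom-insert (us ++ as) bs u<N = S.refl

  length-𝔖 : ∀ n {w} → w ∈ 𝔖 n → length w ≡ n
  length-𝔖 n w∈ = ≡.trans (↭-length (𝔖⇒↭ n w∈)) (length-applyUpTo suc n)

  ∑-splits-term : ∀ m → ∑ (𝔖 m) (λ w → ∑ (splits w) (λ (us , vs) → term us vs)) ≈
                        rising (x + q) m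
  ∑-splits-term zero    = solve 0 (con 1 :* con 1 :+ con 0 :+ con 0 := con 1) S.refl
  ∑-splits-term (suc m) = begin
    ∑ (𝔖 (suc m)) (λ w → ∑ (splits w) (λ (us , vs) → term us vs))
      ≈⟨ ∑-concatMap (insertions (suc m)) (𝔖 m) _ ⟩
    ∑ (𝔖 m) (λ w → ∑ (insertions (suc m) w) (λ w′ → ∑ (splits w′) (λ (us , vs) → term us vs)))
      ≈⟨ ∑-cong (𝔖 m) (λ {w} w∈ → S.trans (∑-splits-insertions (suc m) w term)
           (S.trans (∑-cong (splits w) (step w∈)) (∑-*ˡ (splits w) _ _))) ⟩
    ∑ (𝔖 m) (λ w → (x + q + ι m) * ∑ (splits w) (λ (us , vs) → term us vs))
      ≈⟨ ∑-*ˡ (𝔖 m) _ _ ⟩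
    (x + q + ι m) * ∑ (𝔖 m) (λ w → ∑ (splits w) (λ (us , vs) → term us vs))
      ≈⟨ *-congˡ (∑-splits-term m) ⟩
    (x + q + ι m) * rising (x + q) m
      ≈⟨ *-comm _ _ ⟩
    rising (x + q) (suc m) ∎
    where
    step : ∀ {w} → w ∈ 𝔖 m → ∀ {p} → p ∈ splits w →
      ∑ (insertions (suc m) (proj₁ p)) (λ us′ → term us′ (proj₂ p)) +
      ∑ (insertions (suc m) (proj₂ p)) (λ vs′ → term (proj₁ p) vs′) ≈
      (x + q + ι m) * term (proj₁ p) (proj₂ p)
    step {w} w∈ {us , vs} p∈ with ∈-splits⁻ w p∈
    ... | ≡.refl = S.trans
      (∑-term us vs (All.++⁻ˡ us w<) (All.++⁻ʳ us w<))
      (*-congʳ (+-congˡ (reflexive (≡.cong ι (length-𝔖 m w∈)))))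
      where
      w< : All (_< suc m) (us ++ vs)
      w< = All.map (s≤s ∘ proj₂) (𝔖-letters m w∈)

  -- After complementing, the last insertion of `𝔖 (suc m)` places the letter 1, so the sum runs
  -- over the splits of the words in `𝔖 m`.
  ∑-wnm-rlm : ∀ m → ∑ (𝔖 (suc m)) (λ w → x ^ (wnm w ∸ 1) * q ^ rlm w) ≈
                    rising (x + q) m
  ∑-wnm-rlm m = begin
    ∑ (𝔖 (suc m)) (λ w → x ^ (wnm w ∸ 1) * q ^ rlm w)
      ≈⟨ ∑-↭ _ (map-complementʷ-𝔖 (suc m)) ⟨
    ∑ (map (complementʷ (suc m)) (𝔖 (suc m))) (λ w → x ^ (wnm w ∸ 1) * q ^ rlm w)
      ≡⟨ ∑-map (complementʷ (suc m)) (𝔖 (suc m)) _ ⟩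
    ∑ (𝔖 (suc m)) (λ w → x ^ (wnm (complementʷ (suc m) w) ∸ 1) *
                          q ^ rlm (complementʷ (suc m) w))
      ≈⟨ ∑-cong (𝔖 (suc m)) (λ w∈ → *-congʳ (reflexive (≡.cong (λ n → x ^ (n ∸ 1))
           (wnm≡lrmax (suc m) (complementʷ-𝔖 (suc m) w∈))))) ⟩
    ∑ (𝔖 (suc m)) (λ w → x ^ (lrmax (complementʷ (suc m) w) ∸ 1) *
                          q ^ rlm (complementʷ (suc m) w))
      ≈⟨ ∑-concatMap (insertions (suc m)) (𝔖 m) _ ⟩
    ∑ (𝔖 m) (λ v → ∑ (insertions (suc m) v) (λ w →
      x ^ (lrmax (complementʷ (suc m) w) ∸ 1) * q ^ rlm (complementʷ (suc m) w)))
      ≈⟨ ∑-cong (𝔖 m) (λ {v} v∈ → S.trans (∑-insertions-splits (suc m) v _)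
           (∑-cong (splits v) (step v∈))) ⟩
    ∑ (𝔖 m) (λ v → ∑ (splits v) (λ (us , vs) → term us vs))
      ≈⟨ ∑-splits-term m ⟩
    rising (x + q) m ∎
    where
    step : ∀ {v} → v ∈ 𝔖 m → ∀ {p} → p ∈ splits v →
      let w = complementʷ (suc m) (proj₁ p ++ suc m ∷ proj₂ p) in
      x ^ (lrmax w ∸ 1) * q ^ rlm w ≈ term (proj₁ p) (proj₂ p)
    step {v} v∈ {us , vs} p∈ with ∈-splits⁻ v p∈
    ... | ≡.refl
      rewrite lrmax-complement m us vs (All.map (s≤s ∘ proj₂) (𝔖-letters m v∈))
            | rlm-complement m us vs
                (All.++⁻ˡ us (All.map (s≤s ∘ proj₂) (𝔖-letters m v∈))) = S.refl

theorem1p3 : ∀ {c ℓ} (n : ℕ) → n ≥ 1 →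
    EquallyDistributedOn (𝔖 n)
      (rlm ∷ rlmin ∷ wnm ∷ des ∷ adj321 ∷ [])
      (rlm ∷ wnm ∷ rlmin ∷ des ∷ adj321 ∷ [])
    ×
    ((R : CommutativeRing c ℓ) (x y : CommutativeRing.Carrier R) →
      let open CommutativeRing R
          open Polynomial R
      in (∑[ π ∈ 𝔖 n ] (x ^ (wnm π ∸ 1) * y ^ rlm π)) ≈ rising (x + y) (n ∸ 1))
theorem1p3 (suc m) _ =
  equidistributed-↭ (𝔖 (suc m)) _ _ (StatisticsBag.statistics-↭ m) ,
  λ R x y → RisingFactorial.∑-wnm-rlm R x y m
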